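{- Let $m$ be a positive integer, $S_{2m}$ the symmetric group on $\{1,\dots,2m\}$, and $H$ the centralizer in $S_{2m}$ of $(1\ 2)(3\ 4)\cdots(2m-1\ 2m)$. For any $c>0$, \[\frac{\#\{g\in S_{2m}: |H\cap gHg^{ -1}|<m^c\}}{(2m)!}\longrightarrow 0 \quad\text{as } m\to\infty.\] Consequently, the good elements of $S_{2m}$ (those $g$ with $|H\cap gHg^{ -1}|=m^{O(1)}$) have density zero.
   Context: Probabilities are with respect to the uniform distribution on $S_{2m}$. -}

module Defs where

open import Data.Nat using (ℕ; zero; suc; _*_; _^_; _<?_)
open import Data.Fin using (Fin; zero; suc; _≟_)
open import Data.Fin.Properties using (all?)
open import Data.Vec using (Vec; []; _∷_; lookup; tabulate)
open import Data.Vec.Properties using (≡-dec)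
open import Data.List using (List; []; _∷_; [_]; map; concatMap; allFin; filter; length)
open import Data.List.Relation.Unary.Any using (Any)
import Data.List.Relation.Unary.Any as Any
open import Relation.Nullary.Decidable using (Dec; _×-dec_; _→-dec_)
open import Relation.Binary.PropositionalEquality using (_≡_)
open import Data.Product using (_×_)

-- A map Fin n → Fin n is represented by the vector of its values.
Map : ℕ → Set
Map n = Vec (Fin n) n

vecs : (n k : ℕ) → List (Vec (Fin n) k)
vecs n zero = [ [] ]
vecs n (suc k) = concatMap (λ x → map (x ∷_) (vecs n k)) (allFin n)

-- Being a permutation (an injective self-map of a finite set).
IsPerm : ∀ {n} → Map n → Set
IsPerm {n} v = ∀ (i j : Fin n) → lookup v i ≡ lookup v j → i ≡ j

isPerm? : ∀ {n} (v : Map n) → Dec (IsPerm v)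
isPerm? v = all? (λ i → all? (λ j → (lookup v i ≟ lookup v j) →-dec (i ≟ j)))

Sym : (n : ℕ) → List (Map n)
Sym n = filter isPerm? (vecs n n)

_∘ₚ_ : ∀ {n} → Map n → Map n → Map n
g ∘ₚ h = tabulate (λ i → lookup g (lookup h i))

_≟ₚ_ : ∀ {n} (g h : Map n) → Dec (g ≡ h)
_≟ₚ_ = ≡-dec _≟_

-- Swap of consecutive pairs: 0↔1, 2↔3, ...  On Fin (2 * m) (0-indexed) this is
-- the involution (1 2)(3 4)⋯(2m-1 2m).
swapPairs : ∀ {n} → Fin n → Fin n
swapPairs {suc zero} zero = zero
swapPairs {suc (suc n)} zero = suc zero
swapPairs {suc (suc n)} (suc zero) = zero
swapPairs {suc (suc n)} (suc (suc i)) = suc (suc (swapPairs i))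

σ : (m : ℕ) → Map (2 * m)
σ m = tabulate swapPairs

InH : (m : ℕ) → Map (2 * m) → Set
InH m h = (h ∘ₚ σ m) ≡ (σ m ∘ₚ h)

inH? : (m : ℕ) (h : Map (2 * m)) → Dec (InH m h)
inH? m h = (h ∘ₚ σ m) ≟ₚ (σ m ∘ₚ h)

H : (m : ℕ) → List (Map (2 * m))
H m = filter (inH? m) (Sym (2 * m))

-- x ∈ g H g⁻¹  iff  x = g k g⁻¹ for some k ∈ H, i.e. x ∘ g = g ∘ k.
InConj : (m : ℕ) → Map (2 * m) → Map (2 * m) → Set
InConj m g x = Any (λ k → (x ∘ₚ g) ≡ (g ∘ₚ k)) (H m)

inConj? : (m : ℕ) (g x : Map (2 * m)) → Dec (InConj m g x)
inConj? m g x = Any.any? (λ k → (x ∘ₚ g) ≟ₚ (g ∘ₚ k)) (H m)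

interSize : (m : ℕ) → Map (2 * m) → ℕ
interSize m g = length (filter (λ x → inH? m x ×-dec inConj? m g x) (Sym (2 * m)))

-- #{ g ∈ S_{2m} : |H ∩ gHg⁻¹| < m^(p/q) }, using  N < m^(p/q) ⇔ N^q < m^p.
countSmall : (p q m : ℕ) → ℕ
countSmall p q m = length (filter (λ g → interSize m g ^ q <? m ^ p) (Sym (2 * m)))

{-# OPTIONS --safe #-}
module Submission where

-- Let α be the standard involution and τ = g α g⁻¹. The group H ∩ gHg⁻¹ is the centraliser of
-- ⟨α , τ⟩; the graph with edges {x , α x}, {x , τ x} is a union of cycles, each of which can be
-- rotated independently, so the group has order at least the product of the cycle lengths
-- (counted in pairs). Tracing the cycles of a random g step by step, with n pairs left the current
-- cycle closes with probability 1/(2n−1), independently of the past. Let Z be the number of cycles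
-- of length at least s. A recursion on n bounds E[2^-Z] by a constant times a product of factors
-- 1 − 1/(8j+4) over 3s ≤ j < m, which tends to 0 as m/s → ∞. Taking s a small enough constant
-- multiple of m, there are with probability close to 1 at least 2p cycles of length ≥ s ≥ √m,
-- and then |H ∩ gHg⁻¹| ≥ s^(2p) ≥ m^p.

open import Defs
open import Data.Fin using (Fin; zero; suc; toℕ; fromℕ<)
import Data.Fin as Fin
open import Data.Fin.Properties using (toℕ-injective; toℕ<n; toℕ-fromℕ<; suc-injective)
open import Data.List using (List; []; _∷_; _++_; map; concat; concatMap; cartesianProductWith; allFin; filter; length)
import Data.List as List
open import Data.List.Properties using (map-++; length-map; length-++; length-tabulate; ++-identityʳ; filter-accept; filter-reject)
import Data.List.Properties as List
open import Data.List.Membership.Propositional using (_∈_; _∉_)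
open import Data.List.Membership.Propositional.Properties
open import Data.List.Relation.Unary.All as All using (All; []; _∷_)
import Data.List.Relation.Unary.All.Properties as All
open import Data.List.Relation.Unary.AllPairs using (AllPairs; []; _∷_)
import Data.List.Relation.Unary.AllPairs.Properties as AllPairs
open import Data.List.Relation.Unary.Any as Any using (here; there)
open import Data.List.Relation.Unary.Unique.Propositional using (Unique)
import Data.List.Relation.Unary.Unique.Propositional.Properties as Unique
open import Data.List.Relation.Binary.Permutation.Propositional
  using (_↭_; prep; swap; ↭⇒↭ₛ; ↭-refl; ↭-sym; ↭-trans; ↭-reflexive)
open import Data.List.Relation.Binary.Permutation.Propositional.Properties
  using (∈-resp-↭; ↭-length; shift; shifts; drop-∷)
import Data.List.Relation.Binary.Permutation.Setoid.Properties as Permutationₛ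
open import Data.Nat hiding (_/_; _%_)
open import Data.Nat.DivMod using (_/_; _%_; m/n*n≤m; m≡m%n+[m/n]*n; m%n<n; /-monoˡ-≤; m*n/n≡m)
open import Data.Nat.GeneralisedArithmetic using (iterate)
open import Data.Nat.ListAction using (sum)
open import Data.Nat.ListAction.Properties using (sum-++)
open import Data.Nat.Properties hiding (suc-injective; _≟_)
open import Data.Nat.Tactic.RingSolver using (solve-∀)
open import Data.Product using (_×_; _,_; proj₁; proj₂; ∃; ∃₂; uncurry)
open import Data.Sum using (_⊎_; inj₁; inj₂; [_,_]′)
open import Data.Unit using (⊤; tt)
open import Data.Vec using (Vec; []; _∷_; lookup; tabulate; toList; insertAt; removeAt)
open import Data.Vec.Properties
  using (insertAt-removeAt; lookup∘tabulate; tabulate∘lookup; tabulate-cong; toList-injective; ∷-injective; length-toList; cast-is-id)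
open import Data.Vec.Relation.Unary.All as VecAll using ([]; _∷_)
open import Data.Vec.Relation.Unary.All.Properties using (lookup⁺)
open import Function using (_∘_; id)
open import Relation.Binary.Definitions using (DecidableEquality)
open import Relation.Binary.PropositionalEquality hiding (J)
open import Relation.Nullary using (Dec; yes; no; contradiction)
open import Relation.Nullary.Decidable using (_×-dec_)
open import Relation.Unary using (Decidable)

-- The recursion for E[2^-Z]

-- Markov's inequality is applied to 2^-Z because this moment factorises over the cycles and so
-- obeys a closed recursion in two numbers, the pairs left and the length of the current cycle. The
-- obstacle is to gain anything from it: closing a ripe cycle halves the weight, but the cycle
-- opened next is unripe, and the trivial comparison of a fresh cycle with a ripe one loses the
-- factor 2 again. When at least 3s pairs are left, a fresh cycle is likely enough to reach length s
-- that this loss improves to 3/2. That replaces 4n + 2 by 4n + 3/2 and is the origin of 1 - 1/(8n +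
-- 4). The divergence of the harmonic series is then used through doubling: each doubling of n gains
-- a factor 16/17. Everything stays integral: a cycle of k pairs carries 2^k before its halving, so
-- a configuration on n pairs carries the fixed power 2^n, and ratios are cross-multiplied. The
-- enumeration of configurations depends on α alone, so one list serves all g, each g occurring in
-- it with the cycles of its own τ.

penalty : ℕ → ℕ → ℕ
penalty s l with s ≤? l
... | yes _ = 1
... | no _ = 2

penalty≥1 : ∀ s l → 1 ≤ penalty s l
penalty≥1 s l with s ≤? l
... | yes _ = s≤s z≤n
... | no _ = s≤s z≤n

penalty≤2 : ∀ s l → penalty s l ≤ 2
penalty≤2 s l with s ≤? l
... | yes _ = s≤s z≤n
... | no _ = s≤s (s≤s z≤n)

penalty-large : ∀ {s l} → s ≤ l → penalty s l ≡ 1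
penalty-large {s} {l} s≤l with s ≤? l
... | yes _ = refl
... | no s≰l = contradiction s≤l s≰l

penalty-small : ∀ {s l} → l < s → penalty s l ≡ 2
penalty-small {s} {l} l<s with s ≤? l
... | yes s≤l = contradiction l<s (≤⇒≯ s≤l)
... | no _ = refl

-- weight s n l = oddFactorial n · E[2^-Z], where n pairs are left, the current cycle already has l
-- of them, and oddFactorial n = 2ⁿ(2n−1)!!. For l ≥ s ("ripe") it does not depend on l.
weight : ℕ → ℕ → ℕ → ℕ
weight s zero l = 1
weight s (suc n) l = penalty s (suc l) * weight s n 0 + 4 * n * weight s n (suc l)

-- The value (2n)!/n! that `weight` would take if every cycle were shorter than `s`. With n + 1
-- pairs left, closing the cycle carries 2 of the 4n + 2 units and continuing it the other 4n; a
-- large cycle halves the 2 to 1, which is `penalty`.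
oddFactorial : ℕ → ℕ
oddFactorial zero = 1
oddFactorial (suc n) = (4 * n + 2) * oddFactorial n

oddFactorial>0 : ∀ n → 0 < oddFactorial n
oddFactorial>0 zero = s≤s z≤n
oddFactorial>0 (suc n) = *-mono-≤ (≤-trans (s≤s z≤n) (m≤n+m 2 (4 * n))) (oddFactorial>0 n)

weight≤oddFactorial : ∀ s n l → weight s n l ≤ oddFactorial n
weight≤oddFactorial s zero l = ≤-refl
weight≤oddFactorial s (suc n) l = begin
  penalty s (suc l) * weight s n 0 + 4 * n * weight s n (suc l)
    ≤⟨ +-mono-≤ (*-mono-≤ (penalty≤2 s (suc l)) (weight≤oddFactorial s n 0))
                (*-monoʳ-≤ (4 * n) (weight≤oddFactorial s n (suc l))) ⟩
  2 * oddFactorial n + 4 * n * oddFactorial n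
    ≡⟨ lemma n (oddFactorial n) ⟩
  (4 * n + 2) * oddFactorial n ∎
  where
  open ≤-Reasoning
  lemma : ∀ n o → 2 * o + 4 * n * o ≡ (4 * n + 2) * o
  lemma = solve-∀

weight-ripe : ∀ {s} n {l} → s ≤ l → weight s n l ≡ weight s n s
weight-ripe zero s≤l = refl
weight-ripe {s} (suc n) s≤l = cong₂ (λ a b → a * weight s n 0 + 4 * n * b)
  (trans (penalty-large (m≤n⇒m≤1+n s≤l)) (sym (penalty-large (n≤1+n s))))
  (trans (weight-ripe n (m≤n⇒m≤1+n s≤l)) (sym (weight-ripe n (n≤1+n s))))

weight-ripe-suc : ∀ s n → weight s (suc n) s ≡ weight s n 0 + 4 * n * weight s n s
weight-ripe-suc s n = cong₂ _+_
  (trans (cong (_* weight s n 0) (penalty-large (n≤1+n s))) (*-identityˡ _))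
  (cong (4 * n *_) (weight-ripe n (n≤1+n s)))

ripe≤weight : ∀ s n l → weight s n s ≤ weight s n l
ripe≤weight s zero l = ≤-refl
ripe≤weight s (suc n) l = begin
  weight s (suc n) s                     ≡⟨ weight-ripe-suc s n ⟩
  weight s n 0 + 4 * n * weight s n s    ≡⟨ cong (_+ 4 * n * weight s n s) (*-identityˡ (weight s n 0)) ⟨
  1 * weight s n 0 + 4 * n * weight s n s
    ≤⟨ +-mono-≤ (*-monoˡ-≤ (weight s n 0) (penalty≥1 s (suc l)))
                (*-monoʳ-≤ (4 * n) (ripe≤weight s n (suc l))) ⟩
  weight s (suc n) l ∎
  where open ≤-Reasoning

-- The current cycle accounts for at most one factor 1/2; once it closes, both sides continue from
-- the same fresh state.
weight≤2ripe : ∀ s n l → weight s n l ≤ 2 * weight s n s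
weight≤2ripe s zero l = s≤s z≤n
weight≤2ripe s (suc n) l = begin
  weight s (suc n) l
    ≤⟨ +-mono-≤ (*-monoˡ-≤ (weight s n 0) (penalty≤2 s (suc l)))
                (*-monoʳ-≤ (4 * n) (weight≤2ripe s n (suc l))) ⟩
  2 * weight s n 0 + 4 * n * (2 * weight s n s)
    ≡⟨ lemma n (weight s n 0) (weight s n s) ⟩
  2 * (weight s n 0 + 4 * n * weight s n s)
    ≡⟨ cong (2 *_) (weight-ripe-suc s n) ⟨
  2 * weight s (suc n) s ∎
  where
  open ≤-Reasoning
  lemma : ∀ n v u → 2 * v + 4 * n * (2 * u) ≡ 2 * (v + 4 * n * u)
  lemma = solve-∀

-- A cycle `j` points short of ripeness loses against a ripe one only by closing within the next `j`
-- steps, which has probability of order j/n. The ratio 1 + j/a expresses this, and the induction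
-- trades one traced pair for one unit of `j`.
weight-near-ripe : ∀ {s} a j n l → s ≤ l + j → a + j ≤ n →
  a * weight s n l ≤ (a + j) * weight s n s
weight-near-ripe {s} a zero n l s≤l _ =
  ≤-reflexive (cong₂ _*_ (sym (+-identityʳ a))
    (weight-ripe n (≤-trans s≤l (≤-reflexive (+-identityʳ l)))))
weight-near-ripe a (suc j) zero l _ a+j≤0 = contradiction
  (≤-trans (≤-reflexive (sym (+-suc a j))) a+j≤0) λ ()
weight-near-ripe {s} a (suc j) (suc n) l s≤l+j a+j≤n = begin
  a * (penalty s (suc l) * v + 4 * n * weight s n (suc l))
    ≤⟨ *-monoʳ-≤ a (+-monoˡ-≤ (4 * n * weight s n (suc l)) (*-monoˡ-≤ v (penalty≤2 s (suc l)))) ⟩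
  a * (2 * v + 4 * n * weight s n (suc l))
    ≡⟨ lemma₁ a v n (weight s n (suc l)) ⟩
  a * v + a * v + 4 * n * (a * weight s n (suc l))
    -- One copy of `a * v` is what a ripe cycle would pay. The surplus copy is bounded through
    -- `v ≤ 2 * u` and `a ≤ n`, and is absorbed by the extra `4 * n * u` that appears when `a + j`
    -- grows by one.
    ≤⟨ +-mono-≤ (+-monoʳ-≤ (a * v) (*-mono-≤ a≤n (weight≤2ripe s n 0)))
         (*-monoʳ-≤ (4 * n) (weight-near-ripe a j n (suc l)
           (≤-trans s≤l+j (≤-reflexive (+-suc l j))) a+j≤n′)) ⟩
  a * v + n * (2 * u) + 4 * n * ((a + j) * u)
    ≤⟨ m≤m+n _ ((j + 1) * v + 2 * n * u) ⟩
  a * v + n * (2 * u) + 4 * n * ((a + j) * u) + ((j + 1) * v + 2 * n * u)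
    ≡⟨ lemma₂ a v n u j ⟩
  (a + suc j) * (v + 4 * n * u)
    ≡⟨ cong ((a + suc j) *_) (weight-ripe-suc s n) ⟨
  (a + suc j) * weight s (suc n) s ∎
  where
  open ≤-Reasoning
  u v : ℕ
  u = weight s n s
  v = weight s n 0
  a+j≤n′ : a + j ≤ n
  a+j≤n′ = s≤s⁻¹ (≤-trans (≤-reflexive (sym (+-suc a j))) a+j≤n)
  a≤n : a ≤ n
  a≤n = ≤-trans (m≤m+n a j) a+j≤n′
  lemma₁ : ∀ a v n w → a * (2 * v + 4 * n * w) ≡ a * v + a * v + 4 * n * (a * w)
  lemma₁ = solve-∀
  lemma₂ : ∀ a v n u j → a * v + n * (2 * u) + 4 * n * ((a + j) * u) + ((j + 1) * v + 2 * n * u)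
    ≡ (a + suc j) * (v + 4 * n * u)
  lemma₂ = solve-∀

-- `weight-near-ripe` with a = 2s and j = s bounds the fresh weight by 3/2 of the ripe one, which is
-- where 3s comes from. The step ratio is then (8n + 3)/2, against (8n + 4)/2 for `oddFactorial`.
ripe-decay : ∀ {s} n → 0 < s → 3 * s ≤ n → 2 * weight s (suc n) s ≤ (8 * n + 3) * weight s n s
ripe-decay {s} n 0<s 3s≤n = begin
  2 * weight s (suc n) s ≡⟨ cong (2 *_) (weight-ripe-suc s n) ⟩
  2 * (v + 4 * n * u)    ≡⟨ lemma₁ v n u ⟩
  2 * v + 8 * n * u      ≤⟨ +-monoˡ-≤ (8 * n * u) 2v≤3u ⟩
  3 * u + 8 * n * u      ≡⟨ lemma₂ n u ⟩
  (8 * n + 3) * u ∎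
  where
  open ≤-Reasoning
  u v : ℕ
  u = weight s n s
  v = weight s n 0
  lemma₁ : ∀ v n u → 2 * (v + 4 * n * u) ≡ 2 * v + 8 * n * u
  lemma₁ = solve-∀
  lemma₂ : ∀ n u → 3 * u + 8 * n * u ≡ (8 * n + 3) * u
  lemma₂ = solve-∀
  lemma₃ : ∀ s v → s * (2 * v) ≡ 2 * s * v
  lemma₃ = solve-∀
  lemma₄ : ∀ s u → (2 * s + s) * u ≡ s * (3 * u)
  lemma₄ = solve-∀
  lemma₅ : ∀ s → 2 * s + s ≡ 3 * s
  lemma₅ = solve-∀
  instance s≢0 : NonZero s
           s≢0 = >-nonZero 0<s
  2v≤3u : 2 * v ≤ 3 * u
  2v≤3u = *-cancelˡ-≤ s (begin
    s * (2 * v)     ≡⟨ lemma₃ s v ⟩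
    2 * s * v       ≤⟨ weight-near-ripe (2 * s) s n 0 ≤-refl (≤-trans (≤-reflexive (lemma₅ s)) 3s≤n) ⟩
    (2 * s + s) * u ≡⟨ lemma₄ s u ⟩
    s * (3 * u)     ∎)

-- The ratio weight s n s / oddFactorial n drops by the factor 1 − 1/(8n+4) in each step; over the
-- steps from n to n + i this compares with 1 / (1 + i/(16n)).
ripe-decay-steps : ∀ {s} n i → 0 < s → 3 * s ≤ n → i ≤ n →
  weight s (n + i) s * (16 * n + i) * oddFactorial n ≤ 16 * n * weight s n s * oddFactorial (n + i)
ripe-decay-steps {s} n zero 0<s 3s≤n _ = ≤-reflexive (begin
  weight s (n + 0) s * (16 * n + 0) * oddFactorial n
    ≡⟨ cong (_* oddFactorial n) (cong₂ (λ x y → weight s x s * y) (+-identityʳ n) (+-identityʳ (16 * n))) ⟩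
  weight s n s * (16 * n) * oddFactorial n
    ≡⟨ cong₂ _*_ (*-comm (weight s n s) (16 * n)) (cong oddFactorial (sym (+-identityʳ n))) ⟩
  16 * n * weight s n s * oddFactorial (n + 0) ∎)
  where open ≡-Reasoning
ripe-decay-steps {s} n (suc i) 0<s 3s≤n i<n = *-cancelˡ-≤ 2 (begin
  2 * (weight s (n + suc i) s * (16 * n + suc i) * o)
    ≡⟨ cong (λ x → 2 * (weight s x s * (16 * n + suc i) * o)) (+-suc n i) ⟩
  2 * (weight s (suc N) s * (16 * n + suc i) * o)
    ≡⟨ lemma₁ (weight s (suc N) s) (16 * n + suc i) o ⟩
  2 * weight s (suc N) s * (16 * n + suc i) * o
    ≤⟨ *-monoˡ-≤ o (*-monoˡ-≤ (16 * n + suc i) (ripe-decay N 0<s (≤-trans 3s≤n (m≤m+n n i)))) ⟩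
  (8 * N + 3) * weight s N s * (16 * n + suc i) * o
    ≡⟨ lemma₂ (8 * N + 3) (weight s N s) (16 * n + suc i) o ⟩
  (8 * N + 3) * (16 * n + suc i) * (weight s N s * o)
    ≤⟨ *-monoˡ-≤ (weight s N s * o) slope ⟩
  (8 * N + 4) * (16 * n + i) * (weight s N s * o)
    ≡⟨ lemma₃ (8 * N + 4) (16 * n + i) (weight s N s) o ⟩
  (8 * N + 4) * (weight s N s * (16 * n + i) * o)
    ≤⟨ *-monoʳ-≤ (8 * N + 4) (ripe-decay-steps n i 0<s 3s≤n (<⇒≤ i<n)) ⟩
  (8 * N + 4) * (16 * n * weight s n s * oddFactorial N)
    ≡⟨ lemma₄ N (16 * n * weight s n s) (oddFactorial N) ⟩
  2 * (16 * n * weight s n s * ((4 * N + 2) * oddFactorial N))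
    ≡⟨ cong (λ x → 2 * (16 * n * weight s n s * oddFactorial x)) (+-suc n i) ⟨
  2 * (16 * n * weight s n s * oddFactorial (n + suc i)) ∎)
  where
  open ≤-Reasoning
  N o : ℕ
  N = n + i
  o = oddFactorial n
  lemma₁ : ∀ w k o → 2 * (w * k * o) ≡ 2 * w * k * o
  lemma₁ = solve-∀
  lemma₂ : ∀ x w k o → x * w * k * o ≡ x * k * (w * o)
  lemma₂ = solve-∀
  lemma₃ : ∀ x k w o → x * k * (w * o) ≡ x * (w * k * o)
  lemma₃ = solve-∀
  lemma₄ : ∀ N x o → (8 * N + 4) * (x * o) ≡ 2 * (x * ((4 * N + 2) * o))
  lemma₄ = solve-∀
  lemma₅ : ∀ x n i → (8 * x + 3) * (16 * n + suc i) ≡ (8 * x + 3) * (16 * n + i) + (8 * x + 3)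
  lemma₅ = solve-∀
  lemma₆ : ∀ x n i → (8 * x + 3) * (16 * n + i) + (16 * n + i) ≡ (8 * x + 4) * (16 * n + i)
  lemma₆ = solve-∀
  lemma₇ : ∀ n i → 8 * (n + i) + 3 + 5 ≡ 8 * n + 8 * suc i
  lemma₇ = solve-∀
  lemma₈ : ∀ n → 8 * n + 8 * n ≡ 16 * n
  lemma₈ = solve-∀
  8N+3≤16n+i : 8 * N + 3 ≤ 16 * n + i
  8N+3≤16n+i = begin
    8 * N + 3         ≤⟨ m≤m+n _ 5 ⟩
    8 * N + 3 + 5     ≡⟨ lemma₇ n i ⟩
    8 * n + 8 * suc i ≤⟨ +-monoʳ-≤ (8 * n) (*-monoʳ-≤ 8 i<n) ⟩
    8 * n + 8 * n     ≡⟨ lemma₈ n ⟩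
    16 * n            ≤⟨ m≤m+n _ i ⟩
    16 * n + i        ∎
  -- After cancellation this is 8N + 3 ≤ 16n + i, true for N = n + i as long as i < n; the constant
  -- 16 is chosen for it.
  slope : (8 * N + 3) * (16 * n + suc i) ≤ (8 * N + 4) * (16 * n + i)
  slope = begin
    (8 * N + 3) * (16 * n + suc i)             ≡⟨ lemma₅ N n i ⟩
    (8 * N + 3) * (16 * n + i) + (8 * N + 3)   ≤⟨ +-monoʳ-≤ ((8 * N + 3) * (16 * n + i)) 8N+3≤16n+i ⟩
    (8 * N + 3) * (16 * n + i) + (16 * n + i)  ≡⟨ lemma₆ N n i ⟩
    (8 * N + 4) * (16 * n + i)                 ∎

-- Repeated doubling of the number of pairs

-- In quotients, f y / g y ≤ (q / p) (f x / g x) is followed by the analogous bound from y to z, and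
-- the constants multiply.
ratio-trans : ∀ {f g : ℕ → ℕ} {p q p′ q′ x y z} → 0 < g y →
  p * f y * g x ≤ q * f x * g y → p′ * f z * g y ≤ q′ * f y * g z →
  p′ * p * f z * g x ≤ q′ * q * f x * g z
ratio-trans {f} {g} {p} {q} {p′} {q′} {x} {y} {z} 0<gy xy yz =
  *-cancelʳ-≤ _ _ (g y) ⦃ >-nonZero 0<gy ⦄ (begin
    p′ * p * f z * g x * g y     ≡⟨ lemma₁ p′ p (f z) (g x) (g y) ⟩
    p * g x * (p′ * f z * g y)   ≤⟨ *-monoʳ-≤ (p * g x) yz ⟩
    p * g x * (q′ * f y * g z)   ≡⟨ lemma₂ p (g x) q′ (f y) (g z) ⟩
    q′ * g z * (p * f y * g x)   ≤⟨ *-monoʳ-≤ (q′ * g z) xy ⟩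
    q′ * g z * (q * f x * g y)   ≡⟨ lemma₃ q′ (g z) q (f x) (g y) ⟩
    q′ * q * f x * g z * g y     ∎)
  where
  open ≤-Reasoning
  lemma₁ : ∀ a b c d e → a * b * c * d * e ≡ b * d * (a * c * e)
  lemma₁ = solve-∀
  lemma₂ : ∀ a b c d e → a * b * (c * d * e) ≡ c * e * (a * d * b)
  lemma₂ = solve-∀
  lemma₃ : ∀ a b c d e → a * b * (c * d * e) ≡ a * c * d * b * e
  lemma₃ = solve-∀

-- The case i = n of the preceding bound: 16n / (16n + n) = 16/17.
ripe-doubling : ∀ {s} n → 0 < s → 3 * s ≤ n →
  17 * weight s (2 * n) s * oddFactorial n ≤ 16 * weight s n s * oddFactorial (2 * n)
ripe-doubling {s} n 0<s 3s≤n = *-cancelˡ-≤ n (begin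
  n * (17 * weight s (2 * n) s * oddFactorial n)
    ≡⟨ lemma₁ n (weight s (2 * n) s) (oddFactorial n) ⟩
  weight s (2 * n) s * (16 * n + n) * oddFactorial n
    ≡⟨ cong (λ x → weight s x s * (16 * n + n) * oddFactorial n) (lemma₂ n) ⟩
  weight s (n + n) s * (16 * n + n) * oddFactorial n
    ≤⟨ ripe-decay-steps n n 0<s 3s≤n ≤-refl ⟩
  16 * n * weight s n s * oddFactorial (n + n)
    ≡⟨ cong (λ x → 16 * n * weight s n s * oddFactorial x) (lemma₂ n) ⟨
  16 * n * weight s n s * oddFactorial (2 * n)
    ≡⟨ lemma₃ n (weight s n s) (oddFactorial (2 * n)) ⟩
  n * (16 * weight s n s * oddFactorial (2 * n)) ∎)
  where
  open ≤-Reasoning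
  instance n≢0 : NonZero n
           n≢0 = >-nonZero (≤-trans 0<s (≤-trans (m≤m+n s (2 * s)) 3s≤n))
  lemma₁ : ∀ n w o → n * (17 * w * o) ≡ w * (16 * n + n) * o
  lemma₁ = solve-∀
  lemma₂ : ∀ n → 2 * n ≡ n + n
  lemma₂ = solve-∀
  lemma₃ : ∀ n w o → 16 * n * w * o ≡ n * (16 * w * o)
  lemma₃ = solve-∀

-- Carries an estimate from the special sizes 2^J * 3s to every larger size. The gain of the single
-- steps is given away here, and the monotonicity of the ratio is kept.
ripe-antitone : ∀ {s} n i → 0 < s → 3 * s ≤ n →
  1 * weight s (n + i) s * oddFactorial n ≤ 1 * weight s n s * oddFactorial (n + i)
ripe-antitone {s} n zero 0<s 3s≤n = ≤-reflexive
  (cong₂ (λ x y → 1 * weight s x s * oddFactorial y) (+-identityʳ n) (sym (+-identityʳ n)))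
ripe-antitone {s} n (suc i) 0<s 3s≤n = ratio-trans {λ x → weight s x s} {oddFactorial}
  {1} {1} {1} {1} {n} {n + i} {n + suc i} (oddFactorial>0 (n + i)) (ripe-antitone n i 0<s 3s≤n)
  (subst (λ x → 1 * weight s x s * oddFactorial (n + i) ≤ 1 * weight s (n + i) s * oddFactorial x)
    (sym (+-suc n i)) (*-cancelˡ-≤ 2 (begin
      2 * (1 * weight s (suc (n + i)) s * oddFactorial (n + i))
        ≡⟨ lemma₁ (weight s (suc (n + i)) s) (oddFactorial (n + i)) ⟩
      2 * weight s (suc (n + i)) s * oddFactorial (n + i)
        ≤⟨ *-monoˡ-≤ (oddFactorial (n + i)) (ripe-decay (n + i) 0<s (≤-trans 3s≤n (m≤m+n n i))) ⟩
      (8 * (n + i) + 3) * weight s (n + i) s * oddFactorial (n + i)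
        ≤⟨ *-monoˡ-≤ (oddFactorial (n + i)) (*-monoˡ-≤ (weight s (n + i) s) (+-monoʳ-≤ (8 * (n + i)) (n≤1+n 3))) ⟩
      (8 * (n + i) + 4) * weight s (n + i) s * oddFactorial (n + i)
        ≡⟨ lemma₂ (n + i) (weight s (n + i) s) (oddFactorial (n + i)) ⟩
      2 * (1 * weight s (n + i) s * ((4 * (n + i) + 2) * oddFactorial (n + i))) ∎)))
  where
  open ≤-Reasoning
  lemma₁ : ∀ w o → 2 * (1 * w * o) ≡ 2 * w * o
  lemma₁ = solve-∀
  lemma₂ : ∀ N w o → (8 * N + 4) * w * o ≡ 2 * (1 * w * ((4 * N + 2) * o))
  lemma₂ = solve-∀

ripe-doublings : ∀ {s} J → 0 < s →
  17 ^ J * weight s (2 ^ J * (3 * s)) s * oddFactorial (3 * s) ≤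
  16 ^ J * weight s (3 * s) s * oddFactorial (2 ^ J * (3 * s))
ripe-doublings {s} zero _ = ≤-reflexive
  (cong₂ (λ x y → 1 * weight s x s * oddFactorial y) (*-identityˡ (3 * s)) (sym (*-identityˡ (3 * s))))
ripe-doublings {s} (suc J) 0<s = ratio-trans {λ x → weight s x s} {oddFactorial}
  {17 ^ J} {16 ^ J} {17} {16} {3 * s} {2 ^ J * (3 * s)} {2 ^ suc J * (3 * s)}
  (oddFactorial>0 (2 ^ J * (3 * s))) (ripe-doublings J 0<s)
  (subst (λ x → 17 * weight s x s * oddFactorial (2 ^ J * (3 * s)) ≤
                16 * weight s (2 ^ J * (3 * s)) s * oddFactorial x)
    (sym (*-assoc 2 (2 ^ J) (3 * s)))
    (ripe-doubling (2 ^ J * (3 * s)) 0<s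
      (≤-trans (≤-reflexive (sym (*-identityˡ (3 * s)))) (*-monoˡ-≤ (3 * s) (m^n>0 2 J)))))

bernoulli : ∀ J → (16 + J) * 16 ^ J ≤ 16 * 17 ^ J
bernoulli zero = ≤-refl
bernoulli (suc J) = begin
  (16 + suc J) * (16 * 16 ^ J)                   ≤⟨ m≤m+n _ (J * 16 ^ J) ⟩
  (16 + suc J) * (16 * 16 ^ J) + J * 16 ^ J      ≡⟨ lemma₁ J (16 ^ J) ⟩
  17 * ((16 + J) * 16 ^ J)                       ≤⟨ *-monoʳ-≤ 17 (bernoulli J) ⟩
  17 * (16 * 17 ^ J)                             ≡⟨ lemma₂ (17 ^ J) ⟩
  16 * (17 * 17 ^ J)                             ∎
  where
  open ≤-Reasoning
  lemma₁ : ∀ J x → (16 + suc J) * (16 * x) + J * x ≡ 17 * ((16 + J) * x)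
  lemma₁ = solve-∀
  lemma₂ : ∀ x → 17 * (16 * x) ≡ 16 * (17 * x)
  lemma₂ = solve-∀

ripe-negligible : ∀ {s} C n → 0 < s → 2 ^ (16 * C) * (3 * s) ≤ n →
  suc C * weight s n s ≤ oddFactorial n
ripe-negligible {s} C n 0<s N≤n = *-cancelˡ-≤ (16 ^ J) (*-cancelʳ-≤ _ _ (oddFactorial (3 * s)) (begin
  16 ^ J * (suc C * U n) * O (3 * s)   ≡⟨ lemma₁ (16 ^ J) C (U n) (O (3 * s)) ⟩
  suc C * 16 ^ J * (U n * O (3 * s))   ≤⟨ *-monoˡ-≤ (U n * O (3 * s)) growth ⟩
  17 ^ J * (U n * O (3 * s))           ≡⟨ lemma₂ (17 ^ J) (U n) (O (3 * s)) ⟩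
  1 * 17 ^ J * U n * O (3 * s)
    ≤⟨ ratio-trans {U} {O} {17 ^ J} {16 ^ J} {1} {1} {3 * s} {N} {n} (oddFactorial>0 N) (ripe-doublings J 0<s) N-to-n ⟩
  1 * 16 ^ J * U (3 * s) * O n
    ≤⟨ *-monoˡ-≤ (O n) (*-monoʳ-≤ (1 * 16 ^ J) (weight≤oddFactorial s (3 * s) s)) ⟩
  1 * 16 ^ J * O (3 * s) * O n         ≡⟨ lemma₃ (16 ^ J) (O (3 * s)) (O n) ⟩
  16 ^ J * O n * O (3 * s)             ∎))
  where
  open ≤-Reasoning
  J N : ℕ
  -- By `bernoulli`, (17/16)^(16C) ≥ 1 + C, the factor to be gained.
  J = 16 * C
  N = 2 ^ J * (3 * s)
  U O : ℕ → ℕ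
  U x = weight s x s
  O = oddFactorial
  instance
    16^J≢0 : NonZero (16 ^ J)
    16^J≢0 = m^n≢0 16 J
    O≢0 : NonZero (O (3 * s))
    O≢0 = >-nonZero (oddFactorial>0 (3 * s))
  lemma₁ : ∀ x C u o → x * (suc C * u) * o ≡ suc C * x * (u * o)
  lemma₁ = solve-∀
  lemma₂ : ∀ x u o → x * (u * o) ≡ 1 * x * u * o
  lemma₂ = solve-∀
  lemma₃ : ∀ x o o′ → 1 * x * o * o′ ≡ x * o′ * o
  lemma₃ = solve-∀
  lemma₄ : ∀ C x → 16 * (suc C * x) ≡ (16 + 16 * C) * x
  lemma₄ = solve-∀
  growth : suc C * 16 ^ J ≤ 17 ^ J
  growth = *-cancelˡ-≤ 16 (≤-trans (≤-reflexive (lemma₄ C (16 ^ J))) (bernoulli J))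
  N-to-n : 1 * U n * O N ≤ 1 * U N * O n
  N-to-n = subst (λ x → 1 * U x * O N ≤ 1 * U N * O x) (m+[n∸m]≡n N≤n)
    (ripe-antitone N (n ∸ N) 0<s
      (≤-trans (≤-reflexive (sym (*-identityˡ (3 * s)))) (*-monoˡ-≤ (3 * s) (m^n>0 2 J))))

weight>0 : ∀ s n l → 0 < weight s n l
weight>0 s zero l = s≤s z≤n
weight>0 s (suc n) l = ≤-trans (*-mono-≤ (penalty≥1 s (suc l)) (weight>0 s n 0)) (m≤m+n _ _)

-- Counting in lists

module _ {a} {A : Set a} where

  unique-⊆⇒↭ : ∀ {xs ys : List A} → Unique xs → (∀ {x} → x ∈ xs → x ∈ ys) → ∃ λ zs → ys ↭ xs ++ zs
  unique-⊆⇒↭ {[]} {ys} _ _ = ys , ↭-refl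
  unique-⊆⇒↭ {x ∷ xs} (x∉xs ∷ u) sub with ∈-∃++ (sub (here refl))
  ... | ps , qs , refl with unique-⊆⇒↭ {xs} {ps ++ qs} u sub′
    where
    sub′ : ∀ {z} → z ∈ xs → z ∈ ps ++ qs
    sub′ z∈xs with ∈-resp-↭ (shift x ps qs) (sub (there z∈xs))
    ... | here refl = contradiction refl (All.lookup x∉xs z∈xs)
    ... | there z∈ = z∈
  ... | zs , ps++qs↭ = zs , ↭-trans (shift x ps qs) (prep x ps++qs↭)

  unique-⊆⇒length≤ : ∀ {xs ys : List A} → Unique xs → (∀ {x} → x ∈ xs → x ∈ ys) → length xs ≤ length ys
  unique-⊆⇒length≤ {xs} u sub with unique-⊆⇒↭ u sub
  ... | zs , ys↭ = ≤-trans (m≤m+n (length xs) (length zs))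
    (≤-reflexive (sym (trans (↭-length ys↭) (length-++ xs))))

  unique-⊆-length≡⇒↭ : ∀ {xs ys : List A} → Unique xs → (∀ {x} → x ∈ xs → x ∈ ys) →
    length xs ≡ length ys → xs ↭ ys
  unique-⊆-length≡⇒↭ {xs} u sub eq with unique-⊆⇒↭ u sub
  ... | [] , ys↭ = ↭-sym (↭-trans ys↭ (↭-reflexive (++-identityʳ xs)))
  ... | z ∷ zs , ys↭ = contradiction
    (+-cancelˡ-≡ (length xs) 0 (suc (length zs))
      (trans (+-identityʳ _) (trans eq (trans (↭-length ys↭) (length-++ xs))))) λ ()

module _ {a b} {A : Set a} {B : Set b} where

  injection-length≤ : ∀ {xs : List A} {ys : List B} (f : A → B) → Unique xs →
    (∀ {x y} → x ∈ xs → y ∈ xs → f x ≡ f y → x ≡ y) →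
    (∀ {x} → x ∈ xs → f x ∈ ys) → length xs ≤ length ys
  injection-length≤ {xs} {ys} f u inj f∈ =
    subst (_≤ length ys) (length-map f xs) (unique-⊆⇒length≤ (unique-map u inj) sub)
    where
    unique-map : ∀ {xs} → Unique xs → (∀ {x y} → x ∈ xs → y ∈ xs → f x ≡ f y → x ≡ y) → Unique (map f xs)
    unique-map [] _ = []
    unique-map {x ∷ xs} (x∉xs ∷ u) inj =
      All.tabulate (λ z∈ eq → let (y , y∈xs , fx≡fy) = ∈-map⁻ f z∈ in
        All.lookup x∉xs y∈xs (inj (here refl) (there y∈xs) (trans eq fx≡fy)))
      ∷ unique-map u (λ x∈ y∈ → inj (there x∈) (there y∈))
    sub : ∀ {z} → z ∈ map f xs → z ∈ ys
    sub z∈ = let (x , x∈xs , z≡fx) = ∈-map⁻ f z∈ in subst (_∈ ys) (sym z≡fx) (f∈ x∈xs)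

module _ {a} {A : Set a} where

  sum-map-≤ : ∀ (f g : A → ℕ) xs → (∀ x → f x ≤ g x) → sum (map f xs) ≤ sum (map g xs)
  sum-map-≤ f g [] f≤g = z≤n
  sum-map-≤ f g (x ∷ xs) f≤g = +-mono-≤ (f≤g x) (sum-map-≤ f g xs f≤g)

  sum-map-bounded : ∀ (f : A → ℕ) c xs → (∀ x → f x ≤ c) → sum (map f xs) ≤ length xs * c
  sum-map-bounded f c [] f≤c = z≤n
  sum-map-bounded f c (x ∷ xs) f≤c = +-mono-≤ (f≤c x) (sum-map-bounded f c xs f≤c)

  sum-map-linear : ∀ p q (f g : A → ℕ) xs →
    sum (map (λ x → p * f x + q * g x) xs) ≡ p * sum (map f xs) + q * sum (map g xs)
  sum-map-linear p q f g [] = sym (cong₂ _+_ (*-zeroʳ p) (*-zeroʳ q))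
  sum-map-linear p q f g (x ∷ xs) = trans (cong (p * f x + q * g x +_) (sum-map-linear p q f g xs))
    (lemma p q (f x) (g x) (sum (map f xs)) (sum (map g xs)))
    where
    lemma : ∀ p q f g s t → p * f + q * g + (p * s + q * t) ≡ p * (f + s) + q * (g + t)
    lemma = solve-∀

  sum-map-concatMap : ∀ {b} {B : Set b} (w : B → ℕ) (f : A → List B) xs →
    sum (map w (concatMap f xs)) ≡ sum (map (λ x → sum (map w (f x))) xs)
  sum-map-concatMap w f [] = refl
  sum-map-concatMap w f (x ∷ xs) =
    trans (cong sum (map-++ w (f x) (concatMap f xs)))
      (trans (sum-++ (map w (f x)) _) (cong (sum (map w (f x)) +_) (sum-map-concatMap w f xs)))

-- Enumeration of the configurations by tracing cycles

-- For k > 0, cycleWeight s l k = 2 ^ k, halved if l + k ≥ s, where l counts points of the cycle seen before.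
cycleWeight : ℕ → ℕ → ℕ → ℕ
cycleWeight s l zero = 1
cycleWeight s l (suc k) = 2 ^ k * penalty s (l + suc k)

-- An equality for k > 0. For k = 0 the empty remainder on the right has the default weight 1, and
-- the factor 2 dominates the penalty.
cycleWeight-suc : ∀ s l k → cycleWeight s l (suc k) ≤ 2 * cycleWeight s (suc l) k
cycleWeight-suc s l zero = ≤-trans (≤-reflexive (*-identityˡ _)) (penalty≤2 s (l + 1))
cycleWeight-suc s l (suc k) = ≤-reflexive (trans (*-assoc 2 (2 ^ k) _)
  (cong (λ x → 2 * (2 ^ k * penalty s x)) (+-suc l (suc k))))

Pairs : Set → ℕ → Set
Pairs A n = Vec (A × A) n

Cycles : Set → Set
Cycles A = List (List A)

module _ {A : Set} where

  -- Inverse of a contraction: the pair (w , y) stands for a path from w over x′ and x to y, and is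
  -- split into (x , y) and (x′ , w). The latter may sit at any position and in either order.
  reconnectAt : ∀ {n} → A → A → Pairs A (suc n) × Cycles A → Fin (suc n) → List (Pairs A (suc (suc n)) × Cycles A)
  reconnectAt x x′ (p , []) i = []
  reconnectAt x x′ ((w , y) ∷ L , c ∷ cs) i =
    ((x , y) ∷ insertAt L i (x′ , w) , (x ∷ c) ∷ cs) ∷
    ((x , y) ∷ insertAt L i (w , x′) , (x ∷ c) ∷ cs) ∷ []

  reconnect : ∀ {n} → A → A → Pairs A n × Cycles A → List (Pairs A (suc n) × Cycles A)
  reconnect {zero} x x′ z = []
  reconnect {suc n} x x′ z = concatMap (reconnectAt x x′ z) (allFin (suc n))

  extend : ∀ {n} → A → A → Pairs A n × Cycles A → List (Pairs A (suc n) × Cycles A)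
  extend x x′ (L , cs) = ((x , x′) ∷ L , (x ∷ []) ∷ cs) ∷ reconnect x x′ (L , cs)

  extendBoth : ∀ {n} → A × A → List (Pairs A n × Cycles A) → List (Pairs A (suc n) × Cycles A)
  extendBoth (a , b) zs = concatMap (extend a b) zs ++ concatMap (extend b a) zs

  -- All ways of arranging the points of the pairs O into a list of pairs, each together with the
  -- cycles obtained by alternately following the given pairs and O.
  configs : ∀ n → Pairs A n → List (Pairs A n × Cycles A)
  configs zero O = ([] , []) ∷ []
  configs (suc n) O = concatMap
    (λ i → extendBoth (lookup O i) (configs n (removeAt O i))) (allFin (suc n))

  cyclesWeight : ℕ → ℕ → Cycles A → ℕ
  cyclesWeight s l [] = 1
  cyclesWeight s l (c ∷ cs) = cycleWeight s l (length c) * cyclesWeight s 0 cs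

  totalWeight : ∀ {n} → ℕ → ℕ → List (Pairs A n × Cycles A) → ℕ
  totalWeight s l = sum ∘ map (cyclesWeight s l ∘ proj₂)

  -- The factor 4n collects n positions, two orders of the inserted pair, and 2 for the point added
  -- to the current cycle.
  totalWeight-reconnect : ∀ {n} s l x x′ (z : Pairs A n × Cycles A) →
    totalWeight s l (reconnect x x′ z) ≤ 4 * n * cyclesWeight s (suc l) (proj₂ z)
  totalWeight-reconnect {zero} s l x x′ (L , cs) = z≤n
  totalWeight-reconnect {suc n} s l x x′ (L , []) = ≤-trans
    (≤-reflexive (sum-map-concatMap (cyclesWeight s l ∘ proj₂) (reconnectAt x x′ (L , [])) (allFin (suc n))))
    (≤-trans (sum-map-bounded _ 0 (allFin (suc n)) (λ _ → z≤n))
      (≤-trans (≤-reflexive (*-zeroʳ (length (allFin (suc n))))) z≤n))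
  totalWeight-reconnect {suc n} s l x x′ z@((w , y) ∷ L , c ∷ cs) = begin
    totalWeight s l (reconnect x x′ z)
      ≡⟨ sum-map-concatMap (cyclesWeight s l ∘ proj₂) (reconnectAt x x′ z) (allFin (suc n)) ⟩
    sum (map (λ i → totalWeight s l (reconnectAt x x′ z i)) (allFin (suc n)))
      ≤⟨ sum-map-bounded _ (2 * W) (allFin (suc n)) (λ _ → ≤-refl) ⟩
    length (allFin (suc n)) * (2 * W)
      ≡⟨ cong (_* (2 * W)) (length-tabulate {n = suc n} id) ⟩
    suc n * (2 * W)
      ≤⟨ *-monoʳ-≤ (suc n) (*-monoʳ-≤ 2 (*-monoˡ-≤ (cyclesWeight s 0 cs) (cycleWeight-suc s l (length c)))) ⟩
    suc n * (2 * (2 * cycleWeight s (suc l) (length c) * cyclesWeight s 0 cs))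
      ≡⟨ lemma (suc n) (cycleWeight s (suc l) (length c)) (cyclesWeight s 0 cs) ⟩
    4 * suc n * (cycleWeight s (suc l) (length c) * cyclesWeight s 0 cs) ∎
    where
    open ≤-Reasoning
    W : ℕ
    W = cyclesWeight s l ((x ∷ c) ∷ cs)
    lemma : ∀ n u v → n * (2 * (2 * u * v)) ≡ 4 * n * (u * v)
    lemma = solve-∀

  totalWeight-extend : ∀ {n} s l x x′ (z : Pairs A n × Cycles A) →
    totalWeight s l (extend x x′ z) ≤
    penalty s (suc l) * cyclesWeight s 0 (proj₂ z) + 4 * n * cyclesWeight s (suc l) (proj₂ z)
  totalWeight-extend s l x x′ z = +-mono-≤
    (≤-reflexive (cong (_* cyclesWeight s 0 (proj₂ z))
      (trans (*-identityˡ _) (cong (penalty s) (+-comm l 1)))))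
    (totalWeight-reconnect s l x x′ z)

  -- The offset `l` belongs to the first cycle, the one being traced: a closing resets it to 0 and a
  -- reconnection raises it by one, which reproduces the recursion of `weight`. Choosing a pair and
  -- its first point gives 2(n + 1) cases, the ratio of successive values of 2^n n!.
  totalWeight-configs : ∀ s n l (O : Pairs A n) →
    totalWeight s l (configs n O) ≤ 2 ^ n * n ! * weight s n l
  totalWeight-configs s zero l O = s≤s z≤n
  totalWeight-configs s (suc n) l O = begin
    totalWeight s l (configs (suc n) O)
      ≡⟨ sum-map-concatMap (cyclesWeight s l ∘ proj₂)
           (λ i → extendBoth (lookup O i) (configs n (removeAt O i))) (allFin (suc n)) ⟩
    sum (map (λ i → totalWeight s l (extendBoth (lookup O i) (configs n (removeAt O i)))) (allFin (suc n)))
      ≤⟨ sum-map-bounded _ (E + E) (allFin (suc n)) both ⟩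
    length (allFin (suc n)) * (E + E)
      ≡⟨ cong (_* (E + E)) (length-tabulate {n = suc n} id) ⟩
    suc n * (E + E)
      ≡⟨ lemma n (penalty s (suc l)) (2 ^ n) (n !) (weight s n 0) (weight s n (suc l)) ⟩
    2 ^ suc n * (suc n) ! * weight s (suc n) l ∎
    where
    open ≤-Reasoning
    E : ℕ
    E = penalty s (suc l) * (2 ^ n * n ! * weight s n 0) + 4 * n * (2 ^ n * n ! * weight s n (suc l))
    lemma : ∀ n φ p f v v′ → suc n * ((φ * (p * f * v) + 4 * n * (p * f * v′)) + (φ * (p * f * v) + 4 * n * (p * f * v′)))
      ≡ 2 * p * (suc n * f) * (φ * v + 4 * n * v′)
    lemma = solve-∀
    oriented : ∀ a b (O′ : Pairs A n) → totalWeight s l (concatMap (extend a b) (configs n O′)) ≤ E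
    oriented a b O′ = begin
      totalWeight s l (concatMap (extend a b) (configs n O′))
        ≡⟨ sum-map-concatMap (cyclesWeight s l ∘ proj₂) (extend a b) (configs n O′) ⟩
      sum (map (totalWeight s l ∘ extend a b) (configs n O′))
        ≤⟨ sum-map-≤ _ _ (configs n O′) (totalWeight-extend s l a b) ⟩
      sum (map (λ z → penalty s (suc l) * cyclesWeight s 0 (proj₂ z) + 4 * n * cyclesWeight s (suc l) (proj₂ z)) (configs n O′))
        ≡⟨ sum-map-linear (penalty s (suc l)) (4 * n) _ _ (configs n O′) ⟩
      penalty s (suc l) * totalWeight s 0 (configs n O′) + 4 * n * totalWeight s (suc l) (configs n O′)
        ≤⟨ +-mono-≤ (*-monoʳ-≤ (penalty s (suc l)) (totalWeight-configs s n 0 O′))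
                    (*-monoʳ-≤ (4 * n) (totalWeight-configs s n (suc l) O′)) ⟩
      E ∎
    both : ∀ i → totalWeight s l (extendBoth (lookup O i) (configs n (removeAt O i))) ≤ E + E
    both i with lookup O i
    ... | a , b = begin
      totalWeight s l (xs ++ ys)              ≡⟨ cong sum (map-++ (cyclesWeight s l ∘ proj₂) xs ys) ⟩
      sum (map (cyclesWeight s l ∘ proj₂) xs ++ map (cyclesWeight s l ∘ proj₂) ys)
                                              ≡⟨ sum-++ (map (cyclesWeight s l ∘ proj₂) xs) _ ⟩
      totalWeight s l xs + totalWeight s l ys ≤⟨ +-mono-≤ (oriented a b (removeAt O i)) (oriented b a (removeAt O i)) ⟩
      E + E                                   ∎
      where
      xs ys : List (Pairs A (suc n) × Cycles A)
      xs = concatMap (extend a b) (configs n (removeAt O i))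
      ys = concatMap (extend b a) (configs n (removeAt O i))

  flat : ∀ {n} → Pairs A n → List A
  flat [] = []
  flat ((a , b) ∷ L) = a ∷ b ∷ flat L

  flat-removeAt : ∀ {n} (L : Pairs A (suc n)) i →
    flat L ↭ proj₁ (lookup L i) ∷ proj₂ (lookup L i) ∷ flat (removeAt L i)
  flat-removeAt (p ∷ L) zero = ↭-refl
  flat-removeAt ((a , b) ∷ L@(_ ∷ _)) (suc i) =
    ↭-trans (prep a (prep b (flat-removeAt L i))) (shifts (a ∷ b ∷ []) (_ ∷ _ ∷ []))

  ∈-flat : ∀ {n} (L : Pairs A n) {x} → x ∈ flat L → ∃ λ i → ∃ λ y → lookup L i ≡ (x , y) ⊎ lookup L i ≡ (y , x)
  ∈-flat ((a , b) ∷ L) (here refl) = zero , b , inj₁ refl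
  ∈-flat ((a , b) ∷ L) (there (here refl)) = zero , a , inj₂ refl
  ∈-flat (p ∷ L) (there (there x∈)) = let (i , y , e) = ∈-flat L x∈ in suc i , y , e

allRemoveAt : ∀ {A : Set} {P : A → Set} {n} {xs : Vec A (suc n)} → VecAll.All P xs → ∀ i → VecAll.All P (removeAt xs i)
allRemoveAt (px ∷ pxs) zero = pxs
allRemoveAt (px ∷ pxs@(_ ∷ _)) (suc i) = px ∷ allRemoveAt pxs i

∈-concatMap : ∀ {B C : Set} (f : B → List C) {x y xs} → x ∈ xs → y ∈ f x → y ∈ concatMap f xs
∈-concatMap f x∈xs y∈fx = ∈-concatMap⁺ f (Any.map (λ { refl → y∈fx }) x∈xs)

module _ {A : Set} where

  ∈-extendBoth : ∀ {n} {e} {x x′ : A} {z : Pairs A n × Cycles A} {zs t} → e ≡ (x , x′) ⊎ e ≡ (x′ , x) →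
    z ∈ zs → t ∈ extend x x′ z → t ∈ extendBoth e zs
  ∈-extendBoth {x = x} {x′} (inj₁ refl) z∈ t∈ = ∈-++⁺ˡ (∈-concatMap (extend x x′) z∈ t∈)
  ∈-extendBoth {x = x} {x′} {zs = zs} (inj₂ refl) z∈ t∈ =
    ∈-++⁺ʳ (concatMap (extend x′ x) zs) (∈-concatMap (extend x x′) z∈ t∈)

  ∈-configs : ∀ {n} (O : Pairs A (suc n)) i {x x′} {z t} → lookup O i ≡ (x , x′) ⊎ lookup O i ≡ (x′ , x) →
    z ∈ configs n (removeAt O i) → t ∈ extend x x′ z → t ∈ configs (suc n) O
  ∈-configs {n} O i e z∈ t∈ = ∈-concatMap (λ i → extendBoth (lookup O i) (configs n (removeAt O i)))
    (∈-allFin i) (∈-extendBoth e z∈ t∈)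

-- Every arrangement occurs in the enumeration together with its cycles

module Trace {A : Set} (α : A → A) (α-involutive : ∀ x → α (α x) ≡ x) (α-fixfree : ∀ x → α x ≢ x)
             (R : A → A → Set) (R-sym : ∀ {x y} → R x y → R y x) where

  -- An alternating path that starts and ends with an α-edge. The list records the point at which
  -- each α-pair is entered, so its length counts pairs.
  data Chain : A → List A → A → Set where
    end  : ∀ {x} → Chain x (x ∷ []) (α x)
    step : ∀ {x w c y} → R (α x) w → Chain w c y → Chain x (x ∷ c) y

  Loop : List A → Set
  Loop c = ∃₂ λ x y → Chain x c y × R x y

  -- The first pair need not be related by R: it stands for the R-path that was contracted to it.
  data Traced : ∀ {n} → Pairs A n → Cycles A → Set where
    []  : Traced [] []
    _∷_ : ∀ {n x y c cs} {L : Pairs A n} → Chain x c y → All Loop cs → Traced ((x , y) ∷ L) (c ∷ cs)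

  traced⇒loops : ∀ {n} {L : Pairs A n} {cs} → Traced L cs → VecAll.All (uncurry R) L → All Loop cs
  traced⇒loops [] _ = []
  traced⇒loops (ch ∷ loops) (r ∷ _) = (_ , _ , ch , r) ∷ loops

  orbits : List A → List A
  orbits [] = []
  orbits (x ∷ xs) = x ∷ α x ∷ orbits xs

  IsOrbit : A × A → Set
  IsOrbit (x , y) = y ≡ α x

  pick : ∀ {n} (O : Pairs A (suc n)) → VecAll.All IsOrbit O → ∀ {x} → x ∈ flat O →
    ∃ λ i → (lookup O i ≡ (x , α x) ⊎ lookup O i ≡ (α x , x)) × flat O ↭ x ∷ α x ∷ flat (removeAt O i)
  pick O orb {x} x∈ with ∈-flat O x∈
  ... | i , y , inj₁ e = i , inj₁ e′ ,
    subst (λ p → flat O ↭ proj₁ p ∷ proj₂ p ∷ flat (removeAt O i)) e′ (flat-removeAt O i)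
    where
    e′ : lookup O i ≡ (x , α x)
    e′ = trans e (cong (x ,_) (subst IsOrbit e (lookup⁺ orb i)))
  ... | i , y , inj₂ e = i , inj₂ e′ , ↭-trans
    (subst (λ p → flat O ↭ proj₁ p ∷ proj₂ p ∷ flat (removeAt O i)) e′ (flat-removeAt O i))
    (swap (α x) x ↭-refl)
    where
    e′ : lookup O i ≡ (α x , x)
    e′ = trans e (cong (_, x) (trans (sym (α-involutive y)) (cong α (sym (subst IsOrbit e (lookup⁺ orb i))))))

  TailRelated : ∀ {n} → Pairs A n → Set
  TailRelated [] = ⊤
  TailRelated (p ∷ L) = VecAll.All (uncurry R) L

  all⇒tailRelated : ∀ {n} {L : Pairs A n} → VecAll.All (uncurry R) L → TailRelated L
  all⇒tailRelated [] = tt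
  all⇒tailRelated (_ ∷ rs) = rs

  -- The last component says that the cycles and their α-images exhaust the points with the right
  -- multiplicity. Distinctness within a cycle and disjointness of different cycles are later read
  -- off from it.
  HasTrace : ∀ {n} → Pairs A n → Pairs A n → Set
  HasTrace {n} L O = ∃ λ cs → (L , cs) ∈ configs n O × Traced L cs × orbits (concat cs) ↭ flat L

  hasTrace-closed : ∀ {n x} {L : Pairs A n} (O : Pairs A (suc n)) i →
    lookup O i ≡ (x , α x) ⊎ lookup O i ≡ (α x , x) → VecAll.All (uncurry R) L →
    HasTrace L (removeAt O i) → HasTrace ((x , α x) ∷ L) O
  hasTrace-closed {x = x} O i e rel (cs , cs∈ , traced , cs↭) =
    (x ∷ []) ∷ cs , ∈-configs O i e cs∈ (here refl) ,
    end ∷ traced⇒loops traced rel , prep x (prep (α x) cs↭)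

  flat-contract : ∀ {n x y u w} (L : Pairs A (suc n)) j → lookup L j ≡ (u , w) ⊎ lookup L j ≡ (w , u) →
    flat ((x , y) ∷ L) ↭ x ∷ u ∷ flat ((w , y) ∷ removeAt L j)
  flat-contract {x = x} {y} {u} {w} L j e = prep x (↭-trans (prep y (L↭ e)) (shifts (y ∷ []) (u ∷ w ∷ [])))
    where
    L↭ : lookup L j ≡ (u , w) ⊎ lookup L j ≡ (w , u) → flat L ↭ u ∷ w ∷ flat (removeAt L j)
    L↭ (inj₁ eq) = subst (λ p → flat L ↭ proj₁ p ∷ proj₂ p ∷ flat (removeAt L j)) eq (flat-removeAt L j)
    L↭ (inj₂ eq) = ↭-trans
      (subst (λ p → flat L ↭ proj₁ p ∷ proj₂ p ∷ flat (removeAt L j)) eq (flat-removeAt L j))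
      (swap w u ↭-refl)

  ∈-reconnect : ∀ {n x x′ y w c cs} (L : Pairs A (suc n)) j → lookup L j ≡ (x′ , w) ⊎ lookup L j ≡ (w , x′) →
    ((x , y) ∷ L , (x ∷ c) ∷ cs) ∈ reconnect x x′ ((w , y) ∷ removeAt L j , c ∷ cs)
  ∈-reconnect {x = x} {x′} {y} {w} {c} {cs} L j e =
    ∈-concatMap (reconnectAt x x′ ((w , y) ∷ removeAt L j , c ∷ cs)) (∈-allFin j) (∈-at e)
    where
    restore : ∀ {p} → lookup L j ≡ p → L ≡ insertAt (removeAt L j) j p
    restore eq = trans (sym (insertAt-removeAt L j)) (cong (insertAt (removeAt L j) j) eq)
    ∈-at : lookup L j ≡ (x′ , w) ⊎ lookup L j ≡ (w , x′) →
      ((x , y) ∷ L , (x ∷ c) ∷ cs) ∈ reconnectAt x x′ ((w , y) ∷ removeAt L j , c ∷ cs) j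
    ∈-at (inj₁ eq) = here (cong (λ M → (x , y) ∷ M , (x ∷ c) ∷ cs) (restore eq))
    ∈-at (inj₂ eq) = there (here (cong (λ M → (x , y) ∷ M , (x ∷ c) ∷ cs) (restore eq)))

  hasTrace-contract : ∀ {n x y w} {L : Pairs A (suc n)} (O : Pairs A (suc (suc n))) i →
    lookup O i ≡ (x , α x) ⊎ lookup O i ≡ (α x , x) →
    ∀ j → lookup L j ≡ (α x , w) ⊎ lookup L j ≡ (w , α x) → VecAll.All (uncurry R) L →
    HasTrace ((w , y) ∷ removeAt L j) (removeAt O i) → HasTrace ((x , y) ∷ L) O
  hasTrace-contract {x = x} {y} {w} {L} O i e j e′ rel (c ∷ cs , cs∈ , chain ∷ loops , cs↭) =
    (x ∷ c) ∷ cs , ∈-configs O i e cs∈ (there (∈-reconnect L j e′)) ,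
    step (linked e′) chain ∷ loops ,
    ↭-trans (prep x (prep (α x) cs↭)) (↭-sym (flat-contract L j e′))
    where
    linked : lookup L j ≡ (α x , w) ⊎ lookup L j ≡ (w , α x) → R (α x) w
    linked (inj₁ eq) = subst (uncurry R) eq (lookup⁺ rel j)
    linked (inj₂ eq) = R-sym (subst (uncurry R) eq (lookup⁺ rel j))

  Complete : ℕ → Set
  Complete n = (L O : Pairs A n) → flat L ↭ flat O → VecAll.All IsOrbit O → TailRelated L → HasTrace L O

  -- With x the first point, either L starts with the pair (x , α x), which closes a cycle, or α x
  -- is paired with some w, and contracting the two pairs gives a configuration on the other points.
  complete-suc : ∀ n → Complete n → Complete (suc n)
  complete-suc n complete ((x , y) ∷ L) O L↭O orb rel
    with pick O orb (∈-resp-↭ L↭O (here refl))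
  ... | i , e , O↭ with ∈-resp-↭ (↭-trans (↭-sym O↭) (↭-sym L↭O)) (there (here refl))
  ... | here αx≡x = contradiction αx≡x (α-fixfree x)
  ... | there (here refl) = hasTrace-closed O i e rel (complete L (removeAt O i)
          (drop-∷ (drop-∷ (↭-trans L↭O O↭))) (allRemoveAt orb i) (all⇒tailRelated rel))
  complete-suc zero complete ((x , y) ∷ []) O L↭O orb rel | i , e , O↭ | there (there ())
  complete-suc (suc n) complete ((x , y) ∷ L) O L↭O orb rel | i , e , O↭ | there (there αx∈L)
    with ∈-flat L αx∈L
  ... | j , w , e′ = hasTrace-contract O i e j e′ rel
    (complete ((w , y) ∷ removeAt L j) (removeAt O i)
      (drop-∷ (drop-∷ (↭-trans (↭-sym (flat-contract L j e′)) (↭-trans L↭O O↭))))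
      (allRemoveAt orb i) (allRemoveAt rel j))

  configs-complete : ∀ n → Complete n
  configs-complete zero [] [] _ _ _ = [] , here refl , [] , ↭-refl
  configs-complete (suc n) = complete-suc n (configs-complete n)

-- Elements commuting with both involutions

module _ {A : Set} where

  iterate-commute : ∀ {f h : A → A} → (∀ x → f (h x) ≡ h (f x)) → ∀ n x → iterate f (h x) n ≡ h (iterate f x n)
  iterate-commute comm zero x = refl
  iterate-commute {f} comm (suc n) x = trans (cong (λ z → iterate f z n) (comm x)) (iterate-commute comm n (f x))

  iterate-injective : ∀ {f : A → A} → (∀ {x y} → f x ≡ f y → x ≡ y) →
    ∀ n {x y} → iterate f x n ≡ iterate f y n → x ≡ y
  iterate-injective inj zero e = e
  iterate-injective inj (suc n) e = inj (iterate-injective inj n e)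

  iterate-fixed : ∀ {f : A → A} {x} → f x ≡ x → ∀ n → iterate f x n ≡ x
  iterate-fixed fx≡x zero = refl
  iterate-fixed {f} fx≡x (suc n) = trans (cong (λ z → iterate f z n) fx≡x) (iterate-fixed fx≡x n)

  unique-lookup : ∀ {xs : List A} → Unique xs → ∀ i j → List.lookup xs i ≡ List.lookup xs j → i ≡ j
  unique-lookup (x∉ ∷ u) zero zero e = refl
  unique-lookup (x∉ ∷ u) zero (suc j) e = contradiction e (All.lookup x∉ (∈-lookup j))
  unique-lookup (x∉ ∷ u) (suc i) zero e = contradiction (sym e) (All.lookup x∉ (∈-lookup i))
  unique-lookup (x∉ ∷ u) (suc i) (suc j) e = cong suc (unique-lookup u i j e)

  unique-++⁻ : ∀ (xs : List A) {ys} → Unique (xs ++ ys) →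
    Unique xs × Unique ys × (∀ {z} → z ∈ xs → z ∉ ys)
  unique-++⁻ [] u = [] , u , λ ()
  unique-++⁻ (x ∷ xs) (x∉ ∷ u) with unique-++⁻ xs u
  ... | uxs , uys , dis = (All.++⁻ˡ xs x∉ ∷ uxs) , uys , λ
    { (here refl) z∈ys → contradiction refl (All.lookup (All.++⁻ʳ xs x∉) z∈ys) ; (there z∈xs) → dis z∈xs }

module Centraliser {A : Set} (_≟ᴬ_ : DecidableEquality A) (α τ : A → A)
  (α-involutive : ∀ x → α (α x) ≡ x) (α-fixfree : ∀ x → α x ≢ x) (τ-involutive : ∀ x → τ (τ x) ≡ x) where

  open import Data.List.Membership.DecPropositional _≟ᴬ_ using (_∈?_)

  τ-sym : ∀ {x y} → τ x ≡ y → τ y ≡ x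
  τ-sym {x} τx≡y = trans (cong τ (sym τx≡y)) (τ-involutive x)

  open Trace α α-involutive α-fixfree (λ x y → τ x ≡ y) τ-sym public

  chain-head∈ : ∀ {x c y} → Chain x c y → x ∈ c
  chain-head∈ end = here refl
  chain-head∈ (step _ _) = here refl

  chain-last∈ : ∀ {x c y} → Chain x c y → α y ∈ c
  chain-last∈ {x} end = here (α-involutive x)
  chain-last∈ (step _ ch) = there (chain-last∈ ch)

  chain-next : ∀ {x c y z} → Chain x c y → z ∈ c → τ (α z) ∈ c ⊎ α z ≡ y
  chain-next end (here refl) = inj₂ refl
  chain-next {c = _ ∷ c} (step r ch) (here refl) = inj₁ (there (subst (_∈ c) (sym r) (chain-head∈ ch)))
  chain-next (step r ch) (there z∈) = [ inj₁ ∘ there , inj₂ ]′ (chain-next ch z∈)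

  chain-prev : ∀ {x c y z} → Chain x c y → z ∈ c → z ≡ x ⊎ α (τ z) ∈ c
  chain-prev end (here refl) = inj₁ refl
  chain-prev (step r ch) (here refl) = inj₁ refl
  chain-prev {x} (step r ch) (there z∈) with chain-prev ch z∈
  ... | inj₁ refl = inj₂ (here (trans (cong α (τ-sym r)) (α-involutive x)))
  ... | inj₂ ατz∈ = inj₂ (there ατz∈)

  chain-lookup : ∀ {x c y} → Chain x c y → ∀ i → List.lookup c i ≡ iterate (τ ∘ α) x (toℕ i)
  chain-lookup end zero = refl
  chain-lookup (step r ch) zero = refl
  chain-lookup (step r ch) (suc i) = trans (chain-lookup ch i)
    (cong (λ z → iterate (τ ∘ α) z (toℕ i)) (sym r))

  -- `c` is one half of a cycle of the graph, closed under τ ∘ α and its inverse; the other half is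
  -- its α-image, and `antipode` keeps the two apart.
  record Cycle (c : List A) : Set where
    field
      base     : A
      base∈    : base ∈ c
      next     : ∀ {z} → z ∈ c → τ (α z) ∈ c
      prev     : ∀ {z} → z ∈ c → α (τ z) ∈ c
      antipode : ∀ {z} → z ∈ c → α z ∉ c
      distinct : ∀ {i j} → i < length c → j < length c →
                 iterate (τ ∘ α) base i ≡ iterate (τ ∘ α) base j → i ≡ j

  ∈-orbits : ∀ {z xs} → z ∈ xs → z ∈ orbits xs
  ∈-orbits (here refl) = here refl
  ∈-orbits (there z∈) = there (there (∈-orbits z∈))

  α∈-orbits : ∀ {z xs} → z ∈ xs → α z ∈ orbits xs
  α∈-orbits (here refl) = there (here refl)
  α∈-orbits (there z∈) = there (there (α∈-orbits z∈))

  orbits-++ : ∀ xs ys → orbits (xs ++ ys) ≡ orbits xs ++ orbits ys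
  orbits-++ [] ys = refl
  orbits-++ (x ∷ xs) ys = cong (λ zs → x ∷ α x ∷ zs) (orbits-++ xs ys)

  unique-orbits-antipode : ∀ {xs z} → Unique (orbits xs) → z ∈ xs → α z ∉ xs
  unique-orbits-antipode _ (here refl) (here αz≡z) = contradiction αz≡z (α-fixfree _)
  unique-orbits-antipode (x∉ ∷ αx∉ ∷ u) (here refl) (there αz∈) =
    contradiction refl (All.lookup αx∉ (∈-orbits αz∈))
  unique-orbits-antipode {z = z} (x∉ ∷ αx∉ ∷ u) (there z∈) (here refl) =
    contradiction (α-involutive z) (All.lookup αx∉ (∈-orbits z∈))
  unique-orbits-antipode (_ ∷ _ ∷ u) (there z∈) (there αz∈) = unique-orbits-antipode u z∈ αz∈

  unique-orbits⇒unique : ∀ {xs} → Unique (orbits xs) → Unique xs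
  unique-orbits⇒unique {[]} [] = []
  unique-orbits⇒unique {x ∷ xs} (x∉ ∷ _ ∷ u) =
    All.tabulate (λ z∈ → All.lookup x∉ (there (∈-orbits z∈))) ∷ unique-orbits⇒unique u

  loop⇒cycle : ∀ {c} → Loop c → Unique (orbits c) → Cycle c
  loop⇒cycle {c} (x , y , ch , τx≡y) u = record
    { base = x
    ; base∈ = chain-head∈ ch
    ; next = λ z∈ → [ id , (λ αz≡y → subst (_∈ c) (sym (trans (cong τ αz≡y) (τ-sym τx≡y))) (chain-head∈ ch)) ]′
               (chain-next ch z∈)
    ; prev = λ z∈ → [ (λ { refl → subst (_∈ c) (cong α (sym τx≡y)) (chain-last∈ ch) }) , id ]′ (chain-prev ch z∈)
    ; antipode = unique-orbits-antipode u
    ; distinct = λ i< j< e → trans (sym (toℕ-fromℕ< i<)) (trans (cong toℕ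
        (unique-lookup (unique-orbits⇒unique u) (fromℕ< i<) (fromℕ< j<)
          (trans (lookup-at i<) (trans e (sym (lookup-at j<)))))) (toℕ-fromℕ< j<))
    }
    where
    lookup-at : ∀ {i} (i< : i < length c) → List.lookup c (fromℕ< i<) ≡ iterate (τ ∘ α) x i
    lookup-at i< = trans (chain-lookup ch (fromℕ< i<)) (cong (iterate (τ ∘ α) x) (toℕ-fromℕ< i<))

  Apart : List A → List A → Set
  Apart c c′ = ∀ {z} → z ∈ c → z ∉ c′ × α z ∉ c′

  loops⇒cycles : ∀ {cs} → All Loop cs → Unique (orbits (concat cs)) → All Cycle cs × AllPairs Apart cs
  loops⇒cycles [] _ = [] , []
  loops⇒cycles {c ∷ cs} (l ∷ ls) u
    with unique-++⁻ (orbits c) (subst Unique (orbits-++ c (concat cs)) u)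
  ... | uc , ucs , dis with loops⇒cycles ls ucs
  ... | cyc , apart = loop⇒cycle l uc ∷ cyc ,
    All.tabulate (λ c′∈ z∈c →
      (λ z∈c′ → dis (∈-orbits z∈c) (∈-orbits (∈-concat⁺′ z∈c′ c′∈))) ,
      (λ αz∈c′ → dis (α∈-orbits z∈c) (∈-orbits (∈-concat⁺′ αz∈c′ c′∈)))) ∷ apart

  -- Conjugation by α or by τ turns τ ∘ α into its inverse α ∘ τ, and both involutions exchange the
  -- two halves of the cycle. Moving the halves in opposite directions therefore commutes with both.
  rotate : List A → A → A
  rotate c x with x ∈? c | α x ∈? c
  ... | yes _ | _     = τ (α x)
  ... | no _  | yes _ = α (τ x)
  ... | no _  | no _  = x

  module _ {c : List A} (cyc : Cycle c) where
    open Cycle cyc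

    rotate-∈ : ∀ {x} → x ∈ c → rotate c x ≡ τ (α x)
    rotate-∈ {x} x∈ with x ∈? c | α x ∈? c
    ... | yes _ | _     = refl
    ... | no x∉ | _ = contradiction x∈ x∉

    rotate-α∈ : ∀ {x} → α x ∈ c → rotate c x ≡ α (τ x)
    rotate-α∈ {x} αx∈ with x ∈? c | α x ∈? c
    ... | yes x∈ | _     = contradiction αx∈ (antipode x∈)
    ... | no _ | yes _ = refl
    ... | no _ | no αx∉ = contradiction αx∈ αx∉

  rotate-∉ : ∀ {c x} → x ∉ c → α x ∉ c → rotate c x ≡ x
  rotate-∉ {c} {x} x∉ αx∉ with x ∈? c | α x ∈? c
  ... | yes x∈ | _ = contradiction x∈ x∉
  ... | no _ | yes αx∈ = contradiction αx∈ αx∉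
  ... | no _ | no _ = refl

  data Position (c : List A) (x : A) : Set where
    on       : x ∈ c → Position c x
    opposite : α x ∈ c → Position c x
    off      : x ∉ c → α x ∉ c → Position c x

  position : ∀ c x → Position c x
  position c x with x ∈? c | α x ∈? c
  ... | yes x∈ | _ = on x∈
  ... | no _ | yes αx∈ = opposite αx∈
  ... | no x∉ | no αx∉ = off x∉ αx∉

  record Commuting (π : A → A) : Set where
    field
      commute-α : ∀ x → π (α x) ≡ α (π x)
      commute-τ : ∀ x → π (τ x) ≡ τ (π x)
      injective : ∀ {x y} → π x ≡ π y → x ≡ y

  module _ {c : List A} (cyc : Cycle c) where
    open Cycle cyc

    α∈⇒ : ∀ {x} → x ∈ c → α (α x) ∈ c
    α∈⇒ {x} = subst (_∈ c) (sym (α-involutive x))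

    rotate-commute-α : ∀ x → rotate c (α x) ≡ α (rotate c x)
    rotate-commute-α x with position c x
    ... | on x∈ = trans (rotate-α∈ cyc (α∈⇒ x∈)) (cong α (sym (rotate-∈ cyc x∈)))
    ... | opposite αx∈ = trans (rotate-∈ cyc αx∈) (trans (cong τ (α-involutive x))
            (trans (sym (α-involutive (τ x))) (cong α (sym (rotate-α∈ cyc αx∈)))))
    ... | off x∉ αx∉ = trans (rotate-∉ αx∉ (x∉ ∘ subst (_∈ c) (α-involutive x))) (cong α (sym (rotate-∉ x∉ αx∉)))

    rotate-commute-τ : ∀ x → rotate c (τ x) ≡ τ (rotate c x)
    rotate-commute-τ x with position c x
    ... | on x∈ = trans (rotate-α∈ cyc (prev x∈)) (trans (cong α (τ-involutive x))
            (trans (sym (τ-involutive (α x))) (cong τ (sym (rotate-∈ cyc x∈)))))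
    ... | opposite αx∈ = trans (rotate-∈ cyc (subst (λ z → τ z ∈ c) (α-involutive x) (next αx∈)))
            (cong τ (sym (rotate-α∈ cyc αx∈)))
    ... | off x∉ αx∉ = trans (rotate-∉ τx∉ ατx∉) (cong τ (sym (rotate-∉ x∉ αx∉)))
      where
      τx∉ : τ x ∉ c
      τx∉ τx∈ = αx∉ (subst (λ z → α z ∈ c) (τ-involutive x) (prev τx∈))
      ατx∉ : α (τ x) ∉ c
      ατx∉ ατx∈ = x∉ (subst (_∈ c) (trans (cong τ (α-involutive (τ x))) (τ-involutive x)) (next ατx∈))

    rotate-on : ∀ {x} → x ∈ c → rotate c x ∈ c
    rotate-on x∈ = subst (_∈ c) (sym (rotate-∈ cyc x∈)) (next x∈)

    rotate-opposite : ∀ {x} → α x ∈ c → α (rotate c x) ∈ c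
    rotate-opposite {x} αx∈ = subst (_∈ c) (rotate-commute-α x) (rotate-on αx∈)

    α-injective : ∀ {x y} → α x ≡ α y → x ≡ y
    α-injective {x} {y} e = trans (sym (α-involutive x)) (trans (cong α e) (α-involutive y))

    τ-injective : ∀ {x y} → τ x ≡ τ y → x ≡ y
    τ-injective {x} {y} e = trans (sym (τ-involutive x)) (trans (cong τ e) (τ-involutive y))

    -- Each of the three positions is preserved, so the mixed cases are contradictory and the others
    -- cancel involutions.
    rotate-injective : ∀ {x y} → rotate c x ≡ rotate c y → x ≡ y
    rotate-injective {x} {y} e with position c x | position c y
    ... | on x∈ | on y∈ = α-injective (τ-injective (trans (sym (rotate-∈ cyc x∈)) (trans e (rotate-∈ cyc y∈))))
    ... | on x∈ | opposite y∈ = contradiction (subst (λ z → α z ∈ c) (sym e) (rotate-opposite y∈)) (antipode (rotate-on x∈))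
    ... | on x∈ | off y∉ αy∉ = contradiction (subst (_∈ c) (trans e (rotate-∉ y∉ αy∉)) (rotate-on x∈)) y∉
    ... | opposite x∈ | on y∈ = contradiction (subst (λ z → α z ∈ c) e (rotate-opposite x∈)) (antipode (rotate-on y∈))
    ... | opposite x∈ | opposite y∈ = τ-injective (α-injective (trans (sym (rotate-α∈ cyc x∈)) (trans e (rotate-α∈ cyc y∈))))
    ... | opposite x∈ | off y∉ αy∉ = contradiction (subst (λ z → α z ∈ c) (trans e (rotate-∉ y∉ αy∉)) (rotate-opposite x∈)) αy∉
    ... | off x∉ αx∉ | on y∈ = contradiction (subst (_∈ c) (trans (sym e) (rotate-∉ x∉ αx∉)) (rotate-on y∈)) x∉
    ... | off x∉ αx∉ | opposite y∈ = contradiction (subst (λ z → α z ∈ c) (trans (sym e) (rotate-∉ x∉ αx∉)) (rotate-opposite y∈)) αx∉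
    ... | off x∉ αx∉ | off y∉ αy∉ = trans (sym (rotate-∉ x∉ αx∉)) (trans e (rotate-∉ y∉ αy∉))

    iterate-rotate : ∀ n {x} → x ∈ c → iterate (rotate c) x n ≡ iterate (τ ∘ α) x n
    iterate-rotate zero x∈ = refl
    iterate-rotate (suc n) x∈ = trans (iterate-rotate n (rotate-on x∈)) (cong (λ z → iterate (τ ∘ α) z n) (rotate-∈ cyc x∈))

  -- The exponents are cut to `Fin s` for all cycles alike, so that those for Z cycles form
  -- `vecs s Z`, of length s^Z.
  rotateAll : ∀ {s} (cs : List (List A)) → Vec (Fin s) (length cs) → A → A
  rotateAll [] [] x = x
  rotateAll (c ∷ cs) (t ∷ ts) x = iterate (rotate c) (rotateAll cs ts x) (toℕ t)

  rotateAll-commuting : ∀ {s cs} → All Cycle cs → (ts : Vec (Fin s) (length cs)) → Commuting (rotateAll cs ts)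
  rotateAll-commuting [] [] = record { commute-α = λ _ → refl ; commute-τ = λ _ → refl ; injective = id }
  rotateAll-commuting {cs = c ∷ cs} (cyc ∷ cycs) (t ∷ ts) = record
    { commute-α = λ x → trans (cong (λ z → iterate (rotate c) z (toℕ t)) (commute-α x))
        (iterate-commute (rotate-commute-α cyc) (toℕ t) _)
    ; commute-τ = λ x → trans (cong (λ z → iterate (rotate c) z (toℕ t)) (commute-τ x))
        (iterate-commute (rotate-commute-τ cyc) (toℕ t) _)
    ; injective = injective ∘ iterate-injective (rotate-injective cyc) (toℕ t)
    }
    where open Commuting (rotateAll-commuting cycs ts)

  rotateAll-fixed : ∀ {s cs} (ts : Vec (Fin s) (length cs)) {x} → All (λ c → x ∉ c × α x ∉ c) cs → rotateAll cs ts x ≡ x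
  rotateAll-fixed [] [] = refl
  rotateAll-fixed {cs = c ∷ cs} (t ∷ ts) {x} ((x∉ , αx∉) ∷ ps) =
    trans (cong (λ z → iterate (rotate c) z (toℕ t)) (rotateAll-fixed ts ps)) (iterate-fixed (rotate-∉ x∉ αx∉) (toℕ t))

  -- The base of the first cycle is untouched by the other rotations, so its image reveals the first
  -- exponent, which is below the cycle length. That rotation is then cancelled and the argument
  -- repeats.
  rotateAll-injective : ∀ {s cs} → All Cycle cs → AllPairs Apart cs → All (λ c → s ≤ length c) cs →
    (ts ts′ : Vec (Fin s) (length cs)) → (∀ x → rotateAll cs ts x ≡ rotateAll cs ts′ x) → ts ≡ ts′
  rotateAll-injective [] [] [] [] [] _ = refl
  rotateAll-injective {s} {c ∷ cs} (cyc ∷ cycs) (apart ∷ aparts) (s≤ ∷ ss≤) (t ∷ ts) (t′ ∷ ts′) same =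
    cong₂ _∷_ t≡t′ (rotateAll-injective cycs aparts ss≤ ts ts′ λ x →
      iterate-injective (rotate-injective cyc) (toℕ t) (trans (same x)
        (cong (λ u → iterate (rotate c) (rotateAll cs ts′ x) (toℕ u)) (sym t≡t′))))
    where
    open Cycle cyc
    power : ∀ (u : Fin s) us → rotateAll (c ∷ cs) (u ∷ us) base ≡ iterate (τ ∘ α) base (toℕ u)
    power u us = trans (cong (λ z → iterate (rotate c) z (toℕ u)) (rotateAll-fixed us (All.map (λ p → p base∈) apart)))
      (iterate-rotate cyc (toℕ u) base∈)
    t≡t′ : t ≡ t′
    t≡t′ = toℕ-injective (distinct (≤-trans (toℕ<n t) s≤) (≤-trans (toℕ<n t′) s≤)
      (trans (sym (power t ts)) (trans (same base) (power t′ ts′))))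

-- Permutations as vectors

concatMap-map≡cartesian : ∀ {A B C : Set} (f : A → B → C) xs ys →
  concatMap (λ x → map (f x) ys) xs ≡ cartesianProductWith f xs ys
concatMap-map≡cartesian f [] ys = refl
concatMap-map≡cartesian f (x ∷ xs) ys = cong (map (f x) ys ++_) (concatMap-map≡cartesian f xs ys)

length-cartesian : ∀ {A B C : Set} (f : A → B → C) xs ys →
  length (cartesianProductWith f xs ys) ≡ length xs * length ys
length-cartesian f [] ys = refl
length-cartesian f (x ∷ xs) ys = trans (length-++ (map (f x) ys))
  (cong₂ _+_ (length-map (f x) ys) (length-cartesian f xs ys))

vecs-suc : ∀ n k → vecs n (suc k) ≡ cartesianProductWith _∷_ (allFin n) (vecs n k)
vecs-suc n k = concatMap-map≡cartesian _∷_ (allFin n) (vecs n k)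

length-vecs : ∀ n k → length (vecs n k) ≡ n ^ k
length-vecs n zero = refl
length-vecs n (suc k) = trans (cong length (vecs-suc n k))
  (trans (length-cartesian _∷_ (allFin n) (vecs n k)) (cong₂ _*_ (length-tabulate {n = n} id) (length-vecs n k)))

vecs-unique : ∀ n k → Unique (vecs n k)
vecs-unique n zero = [] ∷ []
vecs-unique n (suc k) = subst Unique (sym (vecs-suc n k))
  (Unique.cartesianProductWith⁺ _∷_ ∷-injective (Unique.allFin⁺ n) (vecs-unique n k))

∈-vecs : ∀ {n k} (v : Vec (Fin n) k) → v ∈ vecs n k
∈-vecs [] = here refl
∈-vecs {n} {suc k} (x ∷ v) = subst (x ∷ v ∈_) (sym (vecs-suc n k))
  (∈-cartesianProductWith⁺ _∷_ (∈-allFin x) (∈-vecs v))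

∈-Sym⁺ : ∀ {n} {g : Map n} → IsPerm g → g ∈ Sym n
∈-Sym⁺ {g = g} perm = ∈-filter⁺ isPerm? (∈-vecs g) perm

∈-Sym⁻ : ∀ {n} {g : Map n} → g ∈ Sym n → IsPerm g
∈-Sym⁻ {n} g∈ = proj₂ (∈-filter⁻ isPerm? {xs = vecs n n} g∈)

Sym-unique : ∀ n → Unique (Sym n)
Sym-unique n = Unique.filter⁺ isPerm? (vecs-unique n n)

-- `2 * suc n` does not compute to two leading successors, while `swapPairs` and `pairUp` consume
-- points two at a time; hence this form and the equations `n ≡ double m`.
double : ℕ → ℕ
double zero = zero
double (suc n) = suc (suc (double n))

2*≡double : ∀ n → 2 * n ≡ double n
2*≡double zero = refl
2*≡double (suc n) = trans (*-suc 2 n) (cong (λ k → suc (suc k)) (2*≡double n))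

swapPairs-involutive : ∀ {n} (i : Fin n) → swapPairs (swapPairs i) ≡ i
swapPairs-involutive {suc zero} zero = refl
swapPairs-involutive {suc (suc n)} zero = refl
swapPairs-involutive {suc (suc n)} (suc zero) = refl
swapPairs-involutive {suc (suc n)} (suc (suc i)) = cong (λ k → suc (suc k)) (swapPairs-involutive i)

swapPairs-fixfree : ∀ m {n} → n ≡ double m → (i : Fin n) → swapPairs i ≢ i
swapPairs-fixfree (suc m) refl zero ()
swapPairs-fixfree (suc m) refl (suc zero) ()
swapPairs-fixfree (suc m) refl (suc (suc i)) e = swapPairs-fixfree m refl i
  (suc-injective (suc-injective e))

-- Both the order of the pairs and the order within them are kept, so that `configs` enumerates
-- permutations and not just matchings.
pairUp : ∀ {A : Set} m {n} → n ≡ double m → Vec A n → Pairs A m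
pairUp zero _ _ = []
pairUp (suc m) refl (x ∷ y ∷ v) = (x , y) ∷ pairUp m refl v

flat-pairUp : ∀ {A : Set} m {n} (eq : n ≡ double m) (v : Vec A n) → flat (pairUp m eq v) ≡ toList v
flat-pairUp zero refl [] = refl
flat-pairUp (suc m) refl (x ∷ y ∷ v) = cong (λ l → x ∷ y ∷ l) (flat-pairUp m refl v)

pairUp-swapPairs : ∀ {A : Set} m {n} (eq : n ≡ double m) (v : Vec A n) →
  VecAll.All (λ p → ∃ λ i → p ≡ (lookup v i , lookup v (swapPairs i))) (pairUp m eq v)
pairUp-swapPairs zero refl [] = []
pairUp-swapPairs (suc m) refl (x ∷ y ∷ v) =
  (zero , refl) ∷ VecAll.map (λ (i , e) → suc (suc i) , e) (pairUp-swapPairs m refl v)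

pairUp-injective : ∀ {A : Set} m {n} (eq : n ≡ double m) {v w : Vec A n} → pairUp m eq v ≡ pairUp m eq w → v ≡ w
pairUp-injective m eq {v} {w} e = trans (sym (cast-is-id refl v)) (toList-injective refl v w
  (trans (sym (flat-pairUp m eq v)) (trans (cong flat e) (flat-pairUp m eq w))))

toList≡tabulate : ∀ {A : Set} {n} (v : Vec A n) → toList v ≡ List.tabulate (lookup v)
toList≡tabulate [] = refl
toList≡tabulate (x ∷ v) = cong (x ∷_) (toList≡tabulate v)

perm-unique : ∀ {n} {g : Map n} → IsPerm g → Unique (toList g)
perm-unique {g = g} perm = subst Unique (sym (toList≡tabulate g)) (Unique.tabulate⁺ (λ {i} {j} → perm i j))

perm-↭ : ∀ {n} {g : Map n} → IsPerm g → toList g ↭ allFin n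
perm-↭ {n} {g} perm = unique-⊆-length≡⇒↭ (perm-unique perm) (λ _ → ∈-allFin _)
  (trans (length-toList g) (sym (length-tabulate id)))

-- Number of large cycles and Markov's inequality

module _ {A : Set} (s : ℕ) where

  large? : Decidable (λ (c : List A) → s ≤ length c)
  large? c = s ≤? length c

  largeCount : Cycles A → ℕ
  largeCount cs = length (filter large? cs)

  cycleWeight-large : ∀ c cs → 0 < length c →
    2 ^ length c * 2 ^ largeCount cs ≤ 2 ^ largeCount (c ∷ cs) * cycleWeight s 0 (length c)
  cycleWeight-large c@(_ ∷ c′) cs _ = by-size (large? c)
    where
    x z : ℕ
    x = 2 ^ length c′
    z = 2 ^ largeCount cs
    lemma₁ : ∀ x z → 2 * x * z ≡ 2 * z * (x * 1)
    lemma₁ = solve-∀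
    lemma₂ : ∀ x z → 2 * x * z ≡ z * (x * 2)
    lemma₂ = solve-∀
    by-size : Dec (s ≤ length c) → 2 * x * z ≤ 2 ^ largeCount (c ∷ cs) * (x * penalty s (length c))
    by-size (yes s≤c) = ≤-reflexive (trans (lemma₁ x z) (sym (cong₂ (λ n φ → 2 ^ n * (x * φ))
      (cong length (filter-accept large? {xs = cs} s≤c)) (penalty-large s≤c))))
    by-size (no s≰c) = ≤-reflexive (trans (lemma₂ x z) (sym (cong₂ (λ n φ → 2 ^ n * (x * φ))
      (cong length (filter-reject large? {xs = cs} s≰c)) (penalty-small (≰⇒> s≰c)))))

  -- In normalised form the weight of the cycles is at least 2^-Z, the direction that Markov's
  -- inequality consumes.
  weight-largeCount : ∀ {cs} → All (λ c → 0 < length c) cs →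
    2 ^ length (concat cs) ≤ 2 ^ largeCount cs * cyclesWeight s 0 cs
  weight-largeCount [] = ≤-refl
  weight-largeCount {c ∷ cs} (0<c ∷ ne) = begin
    2 ^ length (c ++ concat cs)             ≡⟨ cong (2 ^_) (length-++ c) ⟩
    2 ^ (length c + length (concat cs))     ≡⟨ ^-distribˡ-+-* 2 (length c) (length (concat cs)) ⟩
    2 ^ length c * 2 ^ length (concat cs)   ≤⟨ *-monoʳ-≤ (2 ^ length c) (weight-largeCount ne) ⟩
    2 ^ length c * (2 ^ largeCount cs * w)  ≡⟨ *-assoc (2 ^ length c) (2 ^ largeCount cs) w ⟨
    2 ^ length c * 2 ^ largeCount cs * w    ≤⟨ *-monoˡ-≤ w (cycleWeight-large c cs 0<c) ⟩
    2 ^ largeCount (c ∷ cs) * v * w         ≡⟨ *-assoc (2 ^ largeCount (c ∷ cs)) v w ⟩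
    2 ^ largeCount (c ∷ cs) * (v * w)       ∎
    where
    open ≤-Reasoning
    v w : ℕ
    v = cycleWeight s 0 (length c)
    w = cyclesWeight s 0 cs

unique-resp-↭ : ∀ {A : Set} {xs ys : List A} → xs ↭ ys → Unique xs → Unique ys
unique-resp-↭ p = Permutationₛ.Unique-resp-↭ (setoid _) (↭⇒↭ₛ p)

markov : ∀ {A : Set} (w : A → ℕ) a b (xs : List A) →
  length (filter (λ x → a ≤? b * w x) xs) * a ≤ b * sum (map w xs)
markov w a b [] = z≤n
markov w a b (x ∷ xs) = by-weight (a ≤? b * w x)
  where
  large : Decidable (λ x → a ≤ b * w x)
  large x = a ≤? b * w x
  by-weight : Dec (a ≤ b * w x) → length (filter large (x ∷ xs)) * a ≤ b * (w x + sum (map w xs))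
  by-weight (yes a≤) = subst (λ ys → length ys * a ≤ b * (w x + sum (map w xs))) (sym (filter-accept large a≤))
    (≤-trans (+-mono-≤ a≤ (markov w a b xs)) (≤-reflexive (sym (*-distribˡ-+ b (w x) _))))
  by-weight (no a≰) = subst (λ ys → length ys * a ≤ b * (w x + sum (map w xs))) (sym (filter-reject large a≰))
    (≤-trans (markov w a b xs) (*-monoʳ-≤ b (m≤n+m _ (w x))))

lookup-ext : ∀ {A : Set} {n} {v w : Vec A n} → (∀ i → lookup v i ≡ lookup w i) → v ≡ w
lookup-ext {v = v} {w} e = trans (sym (tabulate∘lookup v)) (trans (tabulate-cong e) (tabulate∘lookup w))

lookup-∘ₚ : ∀ {n} (g h : Map n) i → lookup (g ∘ₚ h) i ≡ lookup g (lookup h i)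
lookup-∘ₚ g h = lookup∘tabulate (λ i → lookup g (lookup h i))

-- From the cycles of a permutation to `interSize` and `countSmall`

module _ (m : ℕ) where

  private
    α : Fin (2 * m) → Fin (2 * m)
    α = swapPairs

  InH⁺ : ∀ h → (∀ i → lookup h (α i) ≡ α (lookup h i)) → InH m h
  InH⁺ h comm = tabulate-cong λ i → trans (cong (lookup h) (lookup∘tabulate α i))
    (trans (comm i) (sym (lookup∘tabulate α (lookup h i))))

  module Config (g : Map (2 * m)) (perm : IsPerm g) where

    g⁻¹-witness : ∀ x → ∃ λ i → x ≡ lookup g i
    g⁻¹-witness x = ∈-tabulate⁻ (subst (x ∈_) (toList≡tabulate g) (∈-resp-↭ (↭-sym (perm-↭ perm)) (∈-allFin x)))

    g⁻¹ : Fin (2 * m) → Fin (2 * m)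
    g⁻¹ x = proj₁ (g⁻¹-witness x)

    g-g⁻¹ : ∀ x → lookup g (g⁻¹ x) ≡ x
    g-g⁻¹ x = sym (proj₂ (g⁻¹-witness x))

    g⁻¹-g : ∀ i → g⁻¹ (lookup g i) ≡ i
    g⁻¹-g i = perm _ _ (g-g⁻¹ (lookup g i))

    τ : Fin (2 * m) → Fin (2 * m)
    τ x = lookup g (α (g⁻¹ x))

    τ-g : ∀ i → τ (lookup g i) ≡ lookup g (α i)
    τ-g i = cong (lookup g ∘ α) (g⁻¹-g i)

    τ-involutive : ∀ x → τ (τ x) ≡ x
    τ-involutive x = trans (τ-g (α (g⁻¹ x))) (trans (cong (lookup g) (swapPairs-involutive (g⁻¹ x))) (g-g⁻¹ x))

    open Centraliser Fin._≟_ α τ swapPairs-involutive (swapPairs-fixfree m (2*≡double m)) τ-involutive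

    -- The map g⁻¹ π g, which is the element of `H` that `InConj` asks for.
    conjugate : (Fin (2 * m) → Fin (2 * m)) → Map (2 * m)
    conjugate π = tabulate (λ i → g⁻¹ (π (lookup g i)))

    module _ {π : Fin (2 * m) → Fin (2 * m)} (com : Commuting π) where
      open Commuting com

      commuting⇒perm : IsPerm (tabulate π)
      commuting⇒perm i j e = injective (trans (sym (lookup∘tabulate π i)) (trans e (lookup∘tabulate π j)))

      commuting⇒inH : InH m (tabulate π)
      commuting⇒inH = InH⁺ (tabulate π) λ i → trans (lookup∘tabulate π (α i))
        (trans (commute-α i) (cong α (sym (lookup∘tabulate π i))))

      g-conjugate : ∀ i → lookup g (lookup (conjugate π) i) ≡ π (lookup g i)
      g-conjugate i = trans (cong (lookup g) (lookup∘tabulate _ i)) (g-g⁻¹ (π (lookup g i)))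

      conjugate∈H : conjugate π ∈ H m
      conjugate∈H = ∈-filter⁺ (inH? m) (∈-Sym⁺ conjugate-perm) (InH⁺ (conjugate π) conjugate-commute)
        where
        conjugate-perm : IsPerm (conjugate π)
        conjugate-perm i j e = perm i j (injective
          (trans (sym (g-conjugate i)) (trans (cong (lookup g) e) (g-conjugate j))))
        conjugate-commute : ∀ i → lookup (conjugate π) (α i) ≡ α (lookup (conjugate π) i)
        conjugate-commute i = perm _ _ (begin
          lookup g (lookup (conjugate π) (α i)) ≡⟨ g-conjugate (α i) ⟩
          π (lookup g (α i))                    ≡⟨ cong π (τ-g i) ⟨
          π (τ (lookup g i))                    ≡⟨ commute-τ (lookup g i) ⟩
          τ (π (lookup g i))                    ≡⟨ cong τ (g-conjugate i) ⟨
          τ (lookup g (lookup (conjugate π) i)) ≡⟨ τ-g (lookup (conjugate π) i) ⟩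
          lookup g (α (lookup (conjugate π) i)) ∎)
          where open ≡-Reasoning

      commuting⇒inConj : InConj m g (tabulate π)
      commuting⇒inConj = Any.map (λ { refl → lookup-ext λ i → begin
        lookup (tabulate π ∘ₚ g) i           ≡⟨ lookup-∘ₚ (tabulate π) g i ⟩
        lookup (tabulate π) (lookup g i)     ≡⟨ lookup∘tabulate π (lookup g i) ⟩
        π (lookup g i)                       ≡⟨ g-conjugate i ⟨
        lookup g (lookup (conjugate π) i)    ≡⟨ lookup-∘ₚ g (conjugate π) i ⟨
        lookup (g ∘ₚ conjugate π) i          ∎ }) conjugate∈H
        where open ≡-Reasoning

    -- Exponent vectors over the large cycles inject into the intersection, the small cycles being
    -- left at rest.
    interSize-≥ : ∀ s {cs} → All Cycle cs → AllPairs Apart cs → s ^ largeCount s cs ≤ interSize m g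
    interSize-≥ s {cs} cycles apart = subst (_≤ interSize m g) (length-vecs s (largeCount s cs))
      (injection-length≤ (λ ts → tabulate (rotateAll larges ts)) (vecs-unique s (length larges))
        (λ {ts} {ts′} _ _ e → rotateAll-injective larges-cycle (AllPairs.filter⁺ (large? s) apart)
          (All.all-filter (large? s) cs) ts ts′ λ x →
            trans (sym (lookup∘tabulate _ x)) (trans (cong (λ v → lookup v x) e) (lookup∘tabulate _ x)))
        (λ {ts} _ → let com = rotateAll-commuting larges-cycle ts in
          ∈-filter⁺ (λ x → inH? m x ×-dec inConj? m g x) (∈-Sym⁺ (commuting⇒perm com))
            (commuting⇒inH com , commuting⇒inConj com)))
      where
      larges : Cycles (Fin (2 * m))
      larges = filter (large? s) cs
      larges-cycle : All Cycle larges
      larges-cycle = All.filter⁺ (large? s) cycles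

    base-pairs : Pairs (Fin (2 * m)) m
    base-pairs = pairUp m (2*≡double m) (tabulate id)

    g-pairs : Pairs (Fin (2 * m)) m
    g-pairs = pairUp m (2*≡double m) g

    g-related : VecAll.All (uncurry λ x y → τ x ≡ y) g-pairs
    g-related = VecAll.map (λ { (i , refl) → τ-g i }) (pairUp-swapPairs m (2*≡double m) g)

    traced : HasTrace g-pairs base-pairs
    traced = configs-complete m g-pairs base-pairs
      (subst₂ _↭_ (sym (flat-pairUp m (2*≡double m) g))
        (trans (sym base≡) (sym (flat-pairUp m (2*≡double m) (tabulate id)))) (perm-↭ perm))
      (VecAll.map (λ { (i , refl) → trans (lookup∘tabulate id (α i)) (cong α (sym (lookup∘tabulate id i))) })
        (pairUp-swapPairs m (2*≡double m) (tabulate id)))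
      (all⇒tailRelated g-related)
      where
      base≡ : toList (tabulate id) ≡ allFin (2 * m)
      base≡ = trans (toList≡tabulate (tabulate id)) (List.tabulate-cong (lookup∘tabulate id))

    traced-bounds : ∀ s {cs} → Traced g-pairs cs → orbits (concat cs) ↭ flat g-pairs →
      s ^ largeCount s cs ≤ interSize m g × 2 ^ m ≤ 2 ^ largeCount s cs * cyclesWeight s 0 cs
    traced-bounds s {cs} tr orbits↭ = interSize-≥ s cycles (proj₂ cycles×apart) ,
      subst (λ k → 2 ^ k ≤ 2 ^ largeCount s cs * cyclesWeight s 0 cs) length-concat
        (weight-largeCount s (All.map (λ c → ∈-length (Cycle.base∈ c)) cycles))
      where
      orbits↭g : orbits (concat cs) ↭ toList g
      orbits↭g = ↭-trans orbits↭ (↭-reflexive (flat-pairUp m (2*≡double m) g))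
      cycles×apart : All Cycle cs × AllPairs Apart cs
      cycles×apart = loops⇒cycles (traced⇒loops tr g-related) (unique-resp-↭ (↭-sym orbits↭g) (perm-unique perm))
      cycles : All Cycle cs
      cycles = proj₁ cycles×apart
      length-orbits : ∀ xs → length (orbits xs) ≡ 2 * length xs
      length-orbits [] = refl
      length-orbits (x ∷ xs) = trans (cong (2 +_) (length-orbits xs)) (sym (*-suc 2 (length xs)))
      length-concat : length (concat cs) ≡ m
      length-concat = *-cancelˡ-≡ _ _ 2 (trans (sym (length-orbits (concat cs))) (trans (↭-length orbits↭g) (length-toList g)))

    cycles-bounds : ∀ s → ∃ λ cs → (g-pairs , cs) ∈ configs m base-pairs ×
      s ^ largeCount s cs ≤ interSize m g × 2 ^ m ≤ 2 ^ largeCount s cs * cyclesWeight s 0 cs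
    cycles-bounds s = let (cs , cs∈ , tr , orbits↭) = traced in cs , cs∈ , traced-bounds s tr orbits↭

  -- Otherwise m^p ≤ s^(2p) ≤ s^Z ≤ N ≤ N^q.
  interSize-small⇒few-large : ∀ {s p q N Z} → 0 < s → m ≤ s * s → 0 < q → s ^ Z ≤ N → N ^ q < m ^ p → Z ≤ 2 * p
  interSize-small⇒few-large {s} {p} {q} {N} {Z} 0<s m≤s² 0<q s^Z≤N N^q<m^p with Z ≤? 2 * p
  ... | yes Z≤2p = Z≤2p
  ... | no Z≰2p = contradiction N^q<m^p (≤⇒≯ (begin
    m ^ p          ≤⟨ ^-monoˡ-≤ p m≤s² ⟩
    (s * s) ^ p    ≡⟨ cong (λ k → (s * k) ^ p) (*-identityʳ s) ⟨
    (s ^ 2) ^ p    ≡⟨ ^-*-assoc s 2 p ⟩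
    s ^ (2 * p)    ≤⟨ ^-monoʳ-≤ s (<⇒≤ (≰⇒> Z≰2p)) ⟩
    s ^ Z          ≤⟨ s^Z≤N ⟩
    N              ≡⟨ *-identityʳ N ⟨
    N ^ 1          ≤⟨ ^-monoʳ-≤ N 0<q ⟩
    N ^ q          ∎))
    where
    open ≤-Reasoning
    instance
      s≢0 : NonZero s
      s≢0 = >-nonZero 0<s
      N≢0 : NonZero N
      N≢0 = >-nonZero (≤-trans (m^n>0 s Z) s^Z≤N)

  -- At most 2p large cycles force a weight of at least 2^m / 2^(2p), and Markov's inequality bounds
  -- how many configurations have one. `pairUp` sends distinct g to distinct first components of
  -- such configurations.
  countSmall-≤ : ∀ {s p q} → 0 < s → m ≤ s * s → 0 < q →
    countSmall p q m ≤ 2 ^ (2 * p) * (m ! * weight s m 0)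
  countSmall-≤ {s} {p} {q} 0<s m≤s² 0<q = *-cancelʳ-≤ _ _ (2 ^ m) ⦃ m^n≢0 2 m ⦄ (begin
    countSmall p q m * 2 ^ m
      ≤⟨ *-monoˡ-≤ (2 ^ m) (injection-length≤ {ys = map proj₁ light} (pairUp m (2*≡double m))
           (Unique.filter⁺ small? (Sym-unique (2 * m)))
           (λ _ _ → pairUp-injective m (2*≡double m)) pairs∈light) ⟩
    length (map proj₁ light) * 2 ^ m
      ≡⟨ cong (_* 2 ^ m) (length-map proj₁ light) ⟩
    length light * 2 ^ m
      ≤⟨ markov (cyclesWeight s 0 ∘ proj₂) (2 ^ m) (2 ^ (2 * p)) (configs m O) ⟩
    2 ^ (2 * p) * totalWeight s 0 (configs m O)
      ≤⟨ *-monoʳ-≤ (2 ^ (2 * p)) (totalWeight-configs s m 0 O) ⟩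
    2 ^ (2 * p) * (2 ^ m * m ! * weight s m 0)
      ≡⟨ lemma (2 ^ (2 * p)) (2 ^ m) (m !) (weight s m 0) ⟩
    2 ^ (2 * p) * (m ! * weight s m 0) * 2 ^ m ∎)
    where
    open ≤-Reasoning
    lemma : ∀ a b c d → a * (b * c * d) ≡ a * (c * d) * b
    lemma = solve-∀
    small? : Decidable (λ g → interSize m g ^ q < m ^ p)
    small? g = interSize m g ^ q <? m ^ p
    O : Pairs (Fin (2 * m)) m
    O = pairUp m (2*≡double m) (tabulate id)
    light? : Decidable (λ (z : Pairs (Fin (2 * m)) m × Cycles (Fin (2 * m))) → 2 ^ m ≤ 2 ^ (2 * p) * cyclesWeight s 0 (proj₂ z))
    light? z = 2 ^ m ≤? 2 ^ (2 * p) * cyclesWeight s 0 (proj₂ z)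
    light : List (Pairs (Fin (2 * m)) m × Cycles (Fin (2 * m)))
    light = filter light? (configs m O)
    pairs∈light : ∀ {g} → g ∈ filter small? (Sym (2 * m)) → pairUp m (2*≡double m) g ∈ map proj₁ light
    pairs∈light {g} g∈ =
      let (g∈Sym , small) = ∈-filter⁻ small? {xs = Sym (2 * m)} g∈
          (cs , cs∈ , s^Z≤N , 2^m≤) = Config.cycles-bounds g (∈-Sym⁻ g∈Sym) s
      in ∈-map⁺ proj₁ (∈-filter⁺ light? cs∈ (≤-trans 2^m≤ (*-monoˡ-≤ (cyclesWeight s 0 cs)
           (^-monoʳ-≤ 2 (interSize-small⇒few-large {s} {p} {q} {Z = largeCount s cs} 0<s m≤s² 0<q s^Z≤N small)))))

-- Final estimate and choice of the constants

[2n]!≡n!*oddFactorial : ∀ n → (2 * n) ! ≡ n ! * oddFactorial n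
[2n]!≡n!*oddFactorial zero = refl
[2n]!≡n!*oddFactorial (suc n) = begin
  (2 * suc n) !                                      ≡⟨ cong _! (*-suc 2 n) ⟩
  suc (suc (2 * n)) * (suc (2 * n) * (2 * n) !)      ≡⟨ cong (λ f → suc (suc (2 * n)) * (suc (2 * n) * f)) ([2n]!≡n!*oddFactorial n) ⟩
  suc (suc (2 * n)) * (suc (2 * n) * (n ! * oddFactorial n)) ≡⟨ lemma n (n !) (oddFactorial n) ⟩
  suc n * n ! * ((4 * n + 2) * oddFactorial n)       ∎
  where
  open ≡-Reasoning
  lemma : ∀ n f o → suc (suc (2 * n)) * (suc (2 * n) * (f * o)) ≡ suc n * f * ((4 * n + 2) * o)
  lemma = solve-∀

countSmall-negligible : ∀ {p q s} k m → 0 < s → m ≤ s * s → 0 < q →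
  2 ^ (16 * (2 ^ (2 * p) * 2 * k)) * (3 * s) ≤ m → countSmall p q m * k < (2 * m) !
countSmall-negligible {p} {q} {s} k m 0<s m≤s² 0<q N≤m = begin-strict
  countSmall p q m * k
    ≤⟨ *-monoˡ-≤ k (countSmall-≤ m {s} {p} {q} 0<s m≤s² 0<q) ⟩
  2 ^ (2 * p) * (m ! * weight s m 0) * k
    ≤⟨ *-monoˡ-≤ k (*-monoʳ-≤ (2 ^ (2 * p)) (*-monoʳ-≤ (m !) (weight≤2ripe s m 0))) ⟩
  2 ^ (2 * p) * (m ! * (2 * weight s m s)) * k
    ≡⟨ lemma (2 ^ (2 * p)) (m !) (weight s m s) k ⟩
  m ! * (2 ^ (2 * p) * 2 * k * weight s m s)
    -- With C = 2^(2p) * 2 * k, `ripe-negligible` covers C + 1 copies of the positive weight where C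
    -- are present; the spare copy makes the inequality strict.
    <⟨ *-monoʳ-< (m !) ⦃ m !≢0 ⦄ (<-≤-trans (m<n+m _ (weight>0 s m s))
         (ripe-negligible (2 ^ (2 * p) * 2 * k) m 0<s N≤m)) ⟩
  m ! * oddFactorial m
    ≡⟨ [2n]!≡n!*oddFactorial m ⟨
  (2 * m) ! ∎
  where
  open ≤-Reasoning
  lemma : ∀ a f w k → a * (f * (2 * w)) * k ≡ f * (a * 2 * k * w)
  lemma = solve-∀

2d≤m/d : ∀ m d .⦃ _ : NonZero d ⦄ → 2 * d * d ≤ m → 2 * d ≤ m / d
2d≤m/d m d 2d²≤m = ≤-trans (≤-reflexive (sym (m*n/n≡m (2 * d) d))) (/-monoˡ-≤ d 2d²≤m)

0<m/d : ∀ m d .⦃ _ : NonZero d ⦄ → 2 * d * d ≤ m → 0 < m / d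
0<m/d m d 2d²≤m = ≤-trans (>-nonZero⁻¹ d) (≤-trans (m≤m+n d (d + 0)) (2d≤m/d m d 2d²≤m))

-- With s = m / d, the remainder is less than d ≤ d s, so m ≤ 2 d s, and the lower bound on m gives
-- 2 d ≤ s.
m≤[m/d]² : ∀ m d .⦃ _ : NonZero d ⦄ → 2 * d * d ≤ m → m ≤ m / d * (m / d)
m≤[m/d]² m d 2d²≤m = begin
  m               ≡⟨ m≡m%n+[m/n]*n m d ⟩
  m % d + s * d   ≤⟨ +-monoˡ-≤ (s * d) (<⇒≤ (m%n<n m d)) ⟩
  d + s * d       ≡⟨ cong (_+ s * d) (*-identityʳ d) ⟨
  d * 1 + s * d   ≤⟨ +-monoˡ-≤ (s * d) (*-monoʳ-≤ d (0<m/d m d 2d²≤m)) ⟩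
  d * s + s * d   ≡⟨ lemma d s ⟩
  s * (2 * d)     ≤⟨ *-monoʳ-≤ s (2d≤m/d m d 2d²≤m) ⟩
  s * s           ∎
  where
  open ≤-Reasoning
  s : ℕ
  s = m / d
  lemma : ∀ d s → d * s + s * d ≡ s * (2 * d)
  lemma = solve-∀

a*[3*[m/[a*3]]]≤m : ∀ a m .⦃ _ : NonZero (a * 3) ⦄ → a * (3 * (m / (a * 3))) ≤ m
a*[3*[m/[a*3]]]≤m a m = ≤-trans
  (≤-reflexive (trans (sym (*-assoc a 3 (m / (a * 3)))) (*-comm (a * 3) (m / (a * 3))))) (m/n*n≤m m (a * 3))

theorem0p2 : ∀ (p q : ℕ) → p > 0 → q > 0 →
    ∀ (k : ℕ) → k > 0 →
    ∃ λ M → ∀ (m : ℕ) → m ≥ M → m > 0 → countSmall p q m * k < (2 * m) !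
theorem0p2 p q _ 0<q k _ = 2 * d * d , λ m M≤m _ →
  countSmall-negligible {p} {q} {m / d} k m (0<m/d m d M≤m) (m≤[m/d]² m d M≤m) 0<q (a*[3*[m/[a*3]]]≤m a m)
  where
  a d : ℕ
  -- `a` is the ratio between m and 3s that `ripe-negligible` demands for C = 2^(2p) * 2 * k, and s
  -- = m / (3a) respects it. The threshold 2d² makes s at least 2d, hence s² ≥ m.
  a = 2 ^ (16 * (2 ^ (2 * p) * 2 * k))
  d = a * 3
  instance d≢0 : NonZero d
           d≢0 = m*n≢0 a 3 ⦃ m^n≢0 2 (16 * (2 ^ (2 * p) * 2 * k)) ⦄
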